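{- For every integer $k\geq 29$ there exist infinitely many finite simple graphs $G$ such that $G$ has no $\{P_{2},P_{2k+1}\}$-factor and $$\sum_{0\leq j\leq k-1} c_{2j+1}(G-X)\leq \frac{32k+141}{72k-78}|X| \quad\text{for all } X\subseteq V(G).$$
   Context: For a graph $H$ and an integer $j\geq 1$, $c_{j}(H)$ denotes the number of connected components of $H$ having exactly $j$ vertices. $P_n$ denotes the path on $n$ vertices. A $\{P_2,P_{2k+1}\}$-factor of $G$ is a spanning subgraph of $G$ each of whose components is isomorphic to $P_2$ or to $P_{2k+1}$. -}

module Defs where

open import Data.Fin using (Fin; toℕ)
open import Data.Fin.Properties using (all?; any?) renaming (_≟_ to _≟ᶠ_)
open import Data.Fin.Subset using (Subset; inside; outside; _∈_; _∩_; ∁; ⊤; ∣_∣)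
open import Data.Fin.Subset.Properties using (_∈?_; ∈⊤; x∈p∩q⁺)
open import Data.Integer using (+_)
open import Data.List using (List; []; _∷_; _++_; map; filter; length; upTo; allFin)
open import Data.List.Membership.Propositional using () renaming (_∈_ to _∈ˡ_)
open import Data.List.Membership.Propositional.Properties using (∈-allFin)
open import Data.List.Relation.Unary.Any using (here; there)
open import Data.Nat using (ℕ; zero; suc; _+_; _*_; _∸_; _≤_; _≟_; NonZero; >-nonZero)
open import Data.Nat.ListAction using (sum)
open import Data.Nat.Properties using (m<n⇒0<n∸m; <-≤-trans; *-monoʳ-≤; _<?_; 1+n≢n)
open import Data.Product using (Σ; ∃; _×_; _,_; proj₁; proj₂)
open import Data.Rational using (ℚ; _/_)
open import Data.Sum using (_⊎_; inj₁; inj₂; swap; [_,_]′)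
open import Data.Vec using ([]; _∷_)
open import Function using (_⇔_; mk⇔; _↔_; Equivalence; Inverse; _∘_)
open import Level using (0ℓ)
open import Relation.Binary using (Rel; Decidable; Symmetric)
open import Relation.Binary.Construct.Closure.ReflexiveTransitive using (Star; ε; _◅_; _◅◅_)
open import Relation.Binary.PropositionalEquality using (_≡_; _≢_; refl; sym)
open import Relation.Nullary using (Dec; ¬_)
open import Relation.Nullary.Decidable using (map′; toWitness; _×-dec_; _⊎-dec_; _→-dec_)

-- A finite simple graph whose vertex set is a subset of Fin n.  The ambient
-- type stays fixed under vertex deletion, and every finite simple graph is
-- isomorphic to one of these.
record Graph (n : ℕ) : Set₁ where
  infix 4 _~_ _~?_
  field
    V      : Subset n
    _~_    : Rel (Fin n) 0ℓ
    _~?_   : Decidable _~_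
    ~-sym  : Symmetric _~_
    ~-irr  : ∀ {u} → ¬ (u ~ u)
    ~⇒∈    : ∀ {u v} → u ~ v → u ∈ V

  Vertex : Set
  Vertex = ∃ λ v → v ∈ V

open Graph

FinGraph : Set₁
FinGraph = Σ ℕ Graph

record _≅_ {m n : ℕ} (G : Graph m) (H : Graph n) : Set where
  field
    bijection : Vertex G ↔ Vertex H
    adjacency : ∀ (u v : Vertex G) →
      _~_ G (proj₁ u) (proj₁ v) ⇔
      _~_ H (proj₁ (Inverse.to bijection u)) (proj₁ (Inverse.to bijection v))

infix 4 _≅_

_[_] : ∀ {n} → Graph n → Subset n → Graph n
G [ S ] = record
  { V     = V G ∩ S
  ; _~_   = λ u v → _~_ G u v × u ∈ S × v ∈ S
  ; _~?_  = λ u v → _~?_ G u v ×-dec (u ∈? S) ×-dec (v ∈? S)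
  ; ~-sym = λ { (e , u∈S , v∈S) → ~-sym G e , v∈S , u∈S }
  ; ~-irr = λ { (e , _) → ~-irr G e }
  ; ~⇒∈   = λ { (e , u∈S , _) → x∈p∩q⁺ (~⇒∈ G e , u∈S) }
  }

_-_ : ∀ {n} → Graph n → Subset n → Graph n
G - X = G [ ∁ X ]

infixl 6 _-_

P : (n : ℕ) → Graph n
P n = record
  { V     = ⊤
  ; _~_   = λ i j → toℕ j ≡ suc (toℕ i) ⊎ toℕ i ≡ suc (toℕ j)
  ; _~?_  = λ i j → (toℕ j ≟ suc (toℕ i)) ⊎-dec (toℕ i ≟ suc (toℕ j))
  ; ~-sym = swap
  ; ~-irr = [ 1+n≢n ∘ sym , 1+n≢n ∘ sym ]′
  ; ~⇒∈   = λ _ → ∈⊤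
  }

-- Reachability is decided by the Floyd–Warshall recursion: Via ws u v holds
-- when v can be reached from u with all intermediate vertices taken from ws.
module Reachability {n : ℕ} {R : Rel (Fin n) 0ℓ} (R? : Decidable R) where

  Via : List (Fin n) → Rel (Fin n) 0ℓ
  Via []       u v = u ≡ v ⊎ R u v
  Via (w ∷ ws) u v = Via ws u v ⊎ (Via ws u w × Via ws w v)

  via? : ∀ ws → Decidable (Via ws)
  via? []       u v = (u ≟ᶠ v) ⊎-dec R? u v
  via? (w ∷ ws) u v = via? ws u v ⊎-dec (via? ws u w ×-dec via? ws w v)

  via⇒star : ∀ ws {u v} → Via ws u v → Star R u v
  via⇒star []       (inj₁ refl)    = ε
  via⇒star []       (inj₂ r)       = r ◅ ε
  via⇒star (w ∷ ws) (inj₁ p)       = via⇒star ws p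
  via⇒star (w ∷ ws) (inj₂ (p , q)) = via⇒star ws p ◅◅ via⇒star ws q

  via-base : ∀ ws {u v} → Via [] u v → Via ws u v
  via-base []       p = p
  via-base (w ∷ ws) p = inj₁ (via-base ws p)

  via-trans : ∀ ws {u w v} → w ∈ˡ ws → Via ws u w → Via ws w v → Via ws u v
  via-trans (x ∷ ws) (here refl) p q = inj₂ ([ (λ z → z) , proj₁ ]′ p , [ (λ z → z) , proj₂ ]′ q)
  via-trans (x ∷ ws) (there i) (inj₁ p)       (inj₁ q)       = inj₁ (via-trans ws i p q)
  via-trans (x ∷ ws) (there i) (inj₁ p)       (inj₂ (q , r)) = inj₂ (via-trans ws i p q , r)
  via-trans (x ∷ ws) (there i) (inj₂ (p , q)) (inj₁ r)       = inj₂ (p , via-trans ws i q r)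
  via-trans (x ∷ ws) (there i) (inj₂ (p , _)) (inj₂ (_ , s)) = inj₂ (p , s)

  star⇒via : ∀ {u v} → Star R u v → Via (allFin n) u v
  star⇒via ε        = via-base (allFin n) (inj₁ refl)
  star⇒via (r ◅ rs) =
    via-trans (allFin n) (∈-allFin _) (via-base (allFin n) (inj₂ r)) (star⇒via rs)

  star? : Decidable (Star R)
  star? u v = map′ (via⇒star (allFin n)) star⇒via (via? (allFin n) u v)

Reachable : ∀ {n} → Graph n → Rel (Fin n) 0ℓ
Reachable G = Star (_~_ G)

reachable? : ∀ {n} (G : Graph n) → Decidable (Reachable G)
reachable? G = Reachability.star? (_~?_ G)

-- The vertex sets of the connected components: the classes of V G under
-- reachability.
IsComponent : ∀ {n} → Graph n → Subset n → Set
IsComponent G C = ∃ λ u → u ∈ V G × (∀ v → v ∈ C ⇔ Reachable G u v)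

isComponent? : ∀ {n} (G : Graph n) (C : Subset n) → Dec (IsComponent G C)
isComponent? G C = any? λ u → (u ∈? V G) ×-dec all? λ v →
  map′ (λ { (f , g) → mk⇔ f g }) (λ e → Equivalence.to e , Equivalence.from e)
    (((v ∈? C) →-dec reachable? G u v) ×-dec (reachable? G u v →-dec (v ∈? C)))

allSubsets : ∀ n → List (Subset n)
allSubsets zero    = [] ∷ []
allSubsets (suc n) = map (outside ∷_) (allSubsets n) ++ map (inside ∷_) (allSubsets n)

c : ∀ {n} → ℕ → Graph n → ℕ
c {n} j H = length (filter (λ C → isComponent? H C ×-dec (∣ C ∣ ≟ j)) (allSubsets n))

∑-oddComponents : ∀ {n} → ℕ → Graph n → ℕ
∑-oddComponents k H = sum (map (λ j → c (2 * j + 1) H) (upTo k))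

record IsSpanningSubgraph {n : ℕ} (F G : Graph n) : Set where
  field
    spanning : V F ≡ V G
    subgraph : ∀ {u v} → _~_ F u v → _~_ G u v

HasP₂P₂ₖ₊₁Factor : ∀ {n} → ℕ → Graph n → Set₁
HasP₂P₂ₖ₊₁Factor {n} k G = Σ (Graph n) λ F → IsSpanningSubgraph F G ×
  (∀ C → IsComponent F C → (F [ C ] ≅ P 2) ⊎ (F [ C ] ≅ P (2 * k + 1)))

denominator≢0 : ∀ k → 29 ≤ k → NonZero (72 * k ∸ 78)
denominator≢0 k 29≤k =
  >-nonZero (m<n⇒0<n∸m (<-≤-trans (toWitness {a? = 78 <? 72 * 29} _) (*-monoʳ-≤ 72 29≤k)))

-- The truncated subtraction is exact since 72 k > 78.
coefficient : ∀ k → 29 ≤ k → ℚ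
coefficient k 29≤k = (+ (32 * k + 141) / (72 * k ∸ 78)) {{denominator≢0 k 29≤k}}

fromℕ : ℕ → ℚ
fromℕ m = + m / 1

-- Graphs are counted up to isomorphism, as an infinite sequence of pairwise
-- non-isomorphic ones.
InfinitelyMany : (∀ {n} → Graph n → Set₁) → Set₁
InfinitelyMany Q = Σ (ℕ → FinGraph) λ G →
  (∀ i j → i ≢ j → ¬ (proj₂ (G i) ≅ proj₂ (G j))) × (∀ i → Q (proj₂ (G i)))

{-# OPTIONS --safe #-}

-- The graph is a disjoint union of a large clique, which only serves to make
-- the family infinite, and a core adapted from the nontraceable graphs of
-- toughness close to 9/4 due to Bauer, Broersma and Veldman.  The core consists
-- of m universal hub vertices and of l gadgets on eight vertices, two of them
-- ports; all ports, together with w further vertices, form a clique.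
--
-- No factor: the core has the odd order 2k + 1 + 2t with t ≤ 1, so a factor
-- contains a path on 2k + 1 core vertices that misses at most two of them.  The
-- six inner vertices of a gadget cannot all have degree two within the gadget,
-- since this would close a cycle.  So each gadget has an inner vertex that is an
-- end of the path, is missed by it, or follows or precedes a hub vertex on it;
-- this accounts for at most 2 + t + 2m < l gadgets.
--
-- Few components: unless X contains the hub, the core minus X is connected, and
-- it has a small order only if |X| ≥ 2 + 2t.  If X contains the hub, the
-- components are the one meeting the port clique and at most |X ∩ L| / 2 ≤ 2
-- inside each gadget L.
module Submission where

open import Data.Bool using (Bool; true; false; T; T?; not; _∧_; _∨_)
open import Data.Bool.Properties using (T-≡; T-∧; T-∨)
open import Data.Empty using (⊥; ⊥-elim)
open import Data.Fin using (Fin; zero; suc; toℕ; fromℕ<; inject₁; opposite; _↑ˡ_; _↑ʳ_; combine; remQuot; splitAt; join) renaming (_≟_ to _≟ᶠ_)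
open import Data.Fin.Patterns using (0F; 1F; 2F; 3F; 4F; 5F; 6F; 7F)
open import Data.Fin.Permutation using (permutation; ↔⇒≡)
import Data.Fin.Properties as Fin
open import Data.Fin.Subset using (Subset; inside; outside; _∈_; _⊆_; ∁; ∣_∣) renaming (⊤ to full; _-_ to _∖_)
open import Data.Fin.Subset.Properties using (_∈?_; ∈⊤; ⊆-antisym; x∈p∩q⁻; x∈p∩q⁺; x∉p⇒x∈∁p; x∈∁p⇒x∉p; x∈p∧x≢y⇒x∈p-y; x∈p⇒∣p-x∣<∣p∣)
import Data.Integer as ℤ
import Data.Integer.Properties as ℤ
open import Data.List using (List; []; _∷_; _++_; length; map; concat; filter; upTo) renaming (tabulate to tabulateˡ)
open import Data.List.Membership.DecPropositional (_≟ᶠ_ {8}) using () renaming (_∈?_ to _∈ˡ?_)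
open import Data.List.Membership.Propositional using () renaming (_∈_ to _∈ˡ_)
open import Data.List.Membership.Propositional.Properties using (∈-upTo⁻; ∈-filter⁻; ∈-map⁻; ∈-tabulate⁻)
open import Data.List.Properties using (length-++; length-tabulate)
open import Data.List.Relation.Unary.All using (All; []; _∷_)
import Data.List.Relation.Unary.All as All
import Data.List.Relation.Unary.All.Properties as All
import Data.List.Relation.Unary.AllPairs as AllPairs
import Data.List.Relation.Unary.AllPairs.Properties as AllPairs
open import Data.List.Relation.Unary.Any using (here)
open import Data.List.Relation.Unary.Unique.Propositional using (Unique; []; _∷_)
import Data.List.Relation.Unary.Unique.Propositional.Properties as Unique
open import Data.Nat using (ℕ; zero; suc; _+_; _∸_; _≤_; _<_; z≤n; s≤s; _<ᵇ_; _≤ᵇ_; _≟_; _<?_; _≤?_; _/_; _%_; NonZero) renaming (_*_ to _·_)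
open import Data.Nat.DivMod using (m≡m%n+[m/n]*n; m%n<n)
open import Data.Nat.ListAction using () renaming (sum to sumˡ)
open import Data.Nat.Properties hiding (_≟_; _<?_; _≤?_)
open import Data.Nat.Solver using (module +-*-Solver)
open import Data.Product using (∃; ∃₂; _×_; _,_; proj₁; proj₂; uncurry)
open import Data.Product.Properties using (≡-dec)
open import Data.Rational using (_*_; toℚᵘ) renaming (_≤_ to _≤ℚ_; _/_ to _/ℚ_)
import Data.Rational.Properties as ℚ
open import Data.Rational.Unnormalised using (mkℚᵘ; *≤*) renaming (_*_ to _*ᵘ_)
import Data.Rational.Unnormalised.Properties as ℚᵘ
open import Data.Sum using (_⊎_; inj₁; inj₂; [_,_]′; map₂)
open import Data.Unit using (⊤; tt)
open import Data.Vec using (Vec; []; _∷_; lookup; tabulate)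
open import Data.Vec.Functional using (foldr)
open import Data.Vec.Properties using ([]=⇒lookup; lookup⇒[]=; lookup∘tabulate; ∷-injectiveʳ)
open import Data.Vec.Properties.WithK using ([]=-irrelevant)
open import Algebra.Properties.CommutativeMonoid.Sum +-0-commutativeMonoid using (sum; sum-cong-≗; ∑-distrib-+; sum-permute)
open import Function using (_∘_; Equivalence; Inverse; mk⇔; mk↔ₛ′)
open import Relation.Binary.Construct.Closure.ReflexiveTransitive using (Star; ε; _◅_; _◅◅_; gmap; reverse)
open import Relation.Binary.Definitions using (tri<; tri≈; tri>)
open import Relation.Binary.PropositionalEquality using (_≡_; _≢_; refl; sym; trans; cong; cong₂; subst; subst₂; module ≡-Reasoning)
open import Relation.Nullary using (¬_; Dec; yes; no; does)
open import Relation.Nullary.Decidable using (_×-dec_; _→-dec_; _⊎-dec_; ¬?; True; toWitness; decidable-stable)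
open import Defs
open Graph

-- Counting: Boolean predicates, subsets and duplicate-free lists.

⟦_⟧ : Bool → ℕ
⟦ true ⟧  = 1
⟦ false ⟧ = 0

# : ∀ {n} → (Fin n → Bool) → ℕ
# p = sum (λ i → ⟦ p i ⟧)

sum-mono-≤ : ∀ {n} {f g : Fin n → ℕ} → (∀ i → f i ≤ g i) → sum f ≤ sum g
sum-mono-≤ {zero}  f≤g = z≤n
sum-mono-≤ {suc n} f≤g = +-mono-≤ (f≤g zero) (sum-mono-≤ (f≤g ∘ suc))

sum-const : ∀ n c → sum {n} (λ _ → c) ≡ n · c
sum-const zero    c = refl
sum-const (suc n) c = cong (c +_) (sum-const n c)

*-distribˡ-sum : ∀ {n} c (f : Fin n → ℕ) → c · sum f ≡ sum (λ i → c · f i)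
*-distribˡ-sum {zero}  c f = *-zeroʳ c
*-distribˡ-sum {suc n} c f =
  trans (*-distribˡ-+ c (f zero) _) (cong (c · f zero +_) (*-distribˡ-sum c (f ∘ suc)))

sum-↑ : ∀ m {n} (f : Fin (m + n) → ℕ) → sum f ≡ sum (f ∘ (_↑ˡ n)) + sum (f ∘ (m ↑ʳ_))
sum-↑ zero    f = refl
sum-↑ (suc m) f = trans (cong (f zero +_) (sum-↑ m (f ∘ suc))) (sym (+-assoc (f zero) _ _))

sum-combine : ∀ m {n} (f : Fin (m · n) → ℕ) → sum f ≡ sum (λ i → sum (λ j → f (combine {m} i j)))
sum-combine zero        f = refl
sum-combine (suc m) {n} f = trans (sum-↑ n f) (cong (sum (f ∘ (_↑ˡ m · n)) +_) (sum-combine m (f ∘ (n ↑ʳ_))))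

⟦⟧-mono : ∀ {a b} → (T a → T b) → ⟦ a ⟧ ≤ ⟦ b ⟧
⟦⟧-mono {false}         _ = z≤n
⟦⟧-mono {true}  {true}  _ = ≤-refl
⟦⟧-mono {true}  {false} h = ⊥-elim (h _)

#-mono : ∀ {n} {p q : Fin n → Bool} → (∀ i → T (p i) → T (q i)) → # p ≤ # q
#-mono h = sum-mono-≤ (λ i → ⟦⟧-mono (h i))

#-none : ∀ {n} {p : Fin n → Bool} → (∀ i → ¬ T (p i)) → # p ≡ 0
#-none {n} none = n≤0⇒n≡0 (≤-trans (#-mono none) (≤-reflexive (trans (sum-const n 0) (*-zeroʳ n))))

#-unique : ∀ {n} {p : Fin n → Bool} → (∀ i j → T (p i) → T (p j) → i ≡ j) → # p ≤ 1
#-unique {zero}      _   = z≤n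
#-unique {suc n} {p} uni with p zero in eq
... | false = #-unique λ i j pi pj → suc-inj (uni (suc i) (suc j) pi pj)
  where
    suc-inj : {i j : Fin n} → Fin.suc i ≡ suc j → i ≡ j
    suc-inj refl = refl
... | true  = s≤s (≤-reflexive (#-none λ i pi → case (uni zero (suc i) (subst T (sym eq) _) pi)))
  where
    case : {i : Fin n} → ¬ (zero ≡ Fin.suc i)
    case ()

#-search : ∀ {n} (p : Fin n → Bool) → (∃ λ i → T (p i)) ⊎ # p ≡ 0
#-search {zero}  p = inj₂ refl
#-search {suc n} p with p zero in eq | #-search (p ∘ suc)
... | true  | _            = inj₁ (zero , subst T (sym eq) _)
... | false | inj₁ (i , q) = inj₁ (suc i , q)
... | false | inj₂ q       = inj₂ q

∣∣≡# : ∀ {n} (S : Subset n) → ∣ S ∣ ≡ # (lookup S)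
∣∣≡# []          = refl
∣∣≡# (true ∷ S)  = cong suc (∣∣≡# S)
∣∣≡# (false ∷ S) = ∣∣≡# S

T⇒∈ : ∀ {n} (S : Subset n) {v} → T (lookup S v) → v ∈ S
T⇒∈ S {v} t = lookup⇒[]= v S (Equivalence.to T-≡ t)

∈⇒T : ∀ {n} {S : Subset n} {v} → v ∈ S → T (lookup S v)
∈⇒T v∈S = Equivalence.from T-≡ ([]=⇒lookup v∈S)

module _ {n} {P : Fin n → Set} (P? : ∀ v → Dec (P v)) where

  subsetOf : Subset n
  subsetOf = tabulate (does ∘ P?)

  ∈subsetOf⁺ : ∀ {v} → P v → v ∈ subsetOf
  ∈subsetOf⁺ {v} pv with P? v in eq
  ... | yes _  = lookup⇒[]= v _ (trans (lookup∘tabulate (does ∘ P?) v) (cong does eq))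
  ... | no ¬pv = ⊥-elim (¬pv pv)

  ∈subsetOf⁻ : ∀ {v} → v ∈ subsetOf → P v
  ∈subsetOf⁻ {v} v∈ with P? v in eq
  ... | yes pv = pv
  ... | no _ with trans (sym ([]=⇒lookup v∈)) (trans (lookup∘tabulate (does ∘ P?) v) (cong does eq))
  ...   | ()

-- Every list entry owns a witness in `S` that no other entry can use, so removing the witness of
-- the head keeps those of the tail.
length≤∣∣ : ∀ {A : Set} {n} (R : A → Fin n → Set) → (∀ {x y v} → R x v → R y v → x ≡ y) →
  ∀ {xs} → Unique xs → ∀ {S} → All (λ x → ∃ λ v → v ∈ S × R x v) xs → length xs ≤ ∣ S ∣
length≤∣∣ R inj []         []                     = z≤n
length≤∣∣ R inj (x≢ ∷ uni) ((v , v∈S , r) ∷ all) =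
  ≤-<-trans (length≤∣∣ R inj uni (All.zipWith shrink (x≢ , all))) (x∈p⇒∣p-x∣<∣p∣ v∈S)
  where
    shrink : ∀ {y} → (_ ≢ y) × (∃ λ u → u ∈ _ × R y u) → ∃ λ u → u ∈ _ ∖ v × R y u
    shrink (x≢y , u , u∈S , r′) = u , x∈p∧x≢y⇒x∈p-y u∈S (λ { refl → x≢y (inj r r′) }) , r′

least : ∀ {n} {P : Fin n → Set} → (∀ v → Dec (P v)) → ∀ {u} → P u →
  ∃ λ v → P v × (∀ w → P w → toℕ v ≤ toℕ w)
least {suc n} P? {u} pu with P? zero
least {suc n} P? {u}     pu | yes p0 = zero , p0 , λ _ _ → z≤n
least {suc n} P? {zero}  pu | no ¬p0 = ⊥-elim (¬p0 pu)
least {suc n} P? {suc u} pu | no ¬p0 with least (P? ∘ suc) pu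
... | v , pv , low = suc v , pv , λ { zero p0 → ⊥-elim (¬p0 p0) ; (suc w) pw → s≤s (low w pw) }

length-concat : ∀ {A B : Set} (f : A → List B) xs → length (concat (map f xs)) ≡ sumˡ (map (length ∘ f) xs)
length-concat f []       = refl
length-concat f (x ∷ xs) = trans (length-++ (f x)) (cong (length (f x) +_) (length-concat f xs))

allSubsets-unique : ∀ n → Unique (allSubsets n)
allSubsets-unique zero    = [] ∷ []
allSubsets-unique (suc n) =
  Unique.++⁺ (Unique.map⁺ ∷-injectiveʳ (allSubsets-unique n)) (Unique.map⁺ ∷-injectiveʳ (allSubsets-unique n))
    disjoint
  where
    disjoint : ∀ {S} → ¬ (S ∈ˡ map (outside ∷_) (allSubsets n) × S ∈ˡ map (inside ∷_) (allSubsets n))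
    disjoint (o , i) with ∈-map⁻ (outside ∷_) o | ∈-map⁻ (inside ∷_) i
    ... | _ , _ , refl | _ , _ , ()

-- Connected components and their representatives.

module Components {n} (H : Graph n) where

  reach-sym : ∀ {u v} → Reachable H u v → Reachable H v u
  reach-sym = reverse (~-sym H)

  class : Fin n → Subset n
  class u = subsetOf (reachable? H u)

  class-isComponent : ∀ {u} → u ∈ V H → IsComponent H (class u)
  class-isComponent {u} u∈V = u , u∈V , λ v →
    mk⇔ (∈subsetOf⁻ (reachable? H u)) (∈subsetOf⁺ (reachable? H u))

  component-unique : ∀ {C D} → IsComponent H C → IsComponent H D → ∀ {v} → v ∈ C → v ∈ D → C ≡ D
  component-unique (u , _ , C⇔) (w , _ , D⇔) {v} v∈C v∈D = ⊆-antisym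
    (λ {x} x∈C → Equivalence.from (D⇔ x) (w⟶v ◅◅ reach-sym u⟶v ◅◅ Equivalence.to (C⇔ x) x∈C))
    (λ {x} x∈D → Equivalence.from (C⇔ x) (u⟶v ◅◅ reach-sym w⟶v ◅◅ Equivalence.to (D⇔ x) x∈D))
    where
      u⟶v = Equivalence.to (C⇔ v) v∈C
      w⟶v = Equivalence.to (D⇔ v) v∈D

  reachable-∈V : ∀ {u v} → u ∈ V H → Reachable H u v → v ∈ V H
  reachable-∈V u∈V ε       = u∈V
  reachable-∈V u∈V (e ◅ r) = reachable-∈V (~⇒∈ H (~-sym H e)) r

  -- The vertex of least index stands for its component. Parity is dropped here: counting every
  -- component of order below `2 · k` can only enlarge the number to be bounded.
  record Representative (k : ℕ) (v : Fin n) : Set where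
    constructor rep
    field
      ∈V    : v ∈ V H
      low   : ∀ u → Reachable H v u → toℕ v ≤ toℕ u
      small : ∣ class v ∣ < 2 · k

  representative? : ∀ k v → Dec (Representative k v)
  representative? k v with v ∈? V H | Fin.all? (λ u → reachable? H v u →-dec toℕ v ≤? toℕ u) | ∣ class v ∣ <? 2 · k
  ... | yes a | yes b | yes c = yes (rep a b c)
  ... | no ¬a | _     | _     = no (¬a ∘ Representative.∈V)
  ... | _     | no ¬b | _     = no (¬b ∘ Representative.low)
  ... | _     | _     | no ¬c = no (¬c ∘ Representative.small)

  representatives : ℕ → Subset n
  representatives k = subsetOf (representative? k)

  representative-unique : ∀ {k u v} → Representative k u → Representative k v → Reachable H u v → u ≡ v
  representative-unique (rep _ low _) (rep _ low′ _) r =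
    Fin.toℕ-injective (≤-antisym (low _ r) (low′ _ (reach-sym r)))

  -- Components of different orders are different sets, so the concatenated lists have no
  -- repetition. Each component is marked by its least vertex, which lies in no other component.
  ∑-oddComponents≤ : ∀ k → ∑-oddComponents k H ≤ ∣ representatives k ∣
  ∑-oddComponents≤ k = subst (_≤ ∣ representatives k ∣) (length-concat components (upTo k))
    (length≤∣∣ Marks (λ { (C , v∈C) (D , v∈D) → component-unique C D v∈C v∈D }) unique represented)
    where
      Q? : ∀ j C → Dec (IsComponent H C × ∣ C ∣ ≡ 2 · j + 1)
      Q? j C = isComponent? H C ×-dec (∣ C ∣ ≟ 2 · j + 1)

      components : ℕ → List (Subset n)
      components j = filter (Q? j) (allSubsets n)

      Marks : Subset n → Fin n → Set
      Marks C v = IsComponent H C × v ∈ C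

      disjoint : ∀ {i j} → i ≢ j → ∀ {C} → ¬ (C ∈ˡ components i × C ∈ˡ components j)
      disjoint {i} {j} i≢j (p , q) with ∈-filter⁻ (Q? i) {xs = allSubsets n} p | ∈-filter⁻ (Q? j) {xs = allSubsets n} q
      ... | _ , _ , e | _ , _ , e′ = i≢j (*-cancelˡ-≡ i j 2 (+-cancelʳ-≡ 1 (2 · i) (2 · j) (trans (sym e) e′)))

      unique : Unique (concat (map components (upTo k)))
      unique = Unique.concat⁺
        (All.map⁺ (All.universal (λ j → Unique.filter⁺ (Q? j) (allSubsets-unique n)) (upTo k)))
        (AllPairs.map⁺ (AllPairs.map disjoint (Unique.upTo⁺ k)))

      mark : ∀ {j} → j < k → ∀ {C} → IsComponent H C × ∣ C ∣ ≡ 2 · j + 1 →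
        ∃ λ v → v ∈ representatives k × Marks C v
      mark {j} j<k {C} (isC@(u , u∈V , C⇔) , size) with least (reachable? H u) ε
      ... | v , u⟶v , low = v , ∈subsetOf⁺ (representative? k) (rep v∈V low′ small) , isC , Equivalence.from (C⇔ v) u⟶v
        where
          v∈V = reachable-∈V u∈V u⟶v
          low′ : ∀ w → Reachable H v w → toℕ v ≤ toℕ w
          low′ w r = low w (u⟶v ◅◅ r)
          C≡ : C ≡ class v
          C≡ = component-unique isC (class-isComponent v∈V) (Equivalence.from (C⇔ v) u⟶v) (∈subsetOf⁺ (reachable? H v) ε)
          open ≤-Reasoning
          small : ∣ class v ∣ < 2 · k
          small = begin-strict
            ∣ class v ∣     ≡⟨ cong ∣_∣ C≡ ⟨
            ∣ C ∣           ≡⟨ size ⟩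
            2 · j + 1       <⟨ +-monoʳ-< (2 · j) (s≤s (s≤s z≤n)) ⟩
            2 · j + 2       ≡⟨ trans (+-comm (2 · j) 2) (sym (*-suc 2 j)) ⟩
            2 · suc j       ≤⟨ *-monoʳ-≤ 2 j<k ⟩
            2 · k           ∎

      represented : All (λ C → ∃ λ v → v ∈ representatives k × Marks C v) (concat (map components (upTo k)))
      represented = All.concat⁺ (All.map⁺ (All.tabulate λ {j} j∈ →
        All.map (mark (∈-upTo⁻ j∈)) (All.all-filter (Q? j) (allSubsets n))))

-- The gadget and the components cut off from its ports.

-- Row by row: the 4-cycle 0123, then the apexes 4, 5, 6, 7 of triangles
-- erected on its edges 01, 12, 23, 30.
gadget : Vec (Vec Bool 8) 8
gadget =
  (f ∷ t ∷ f ∷ t ∷ t ∷ f ∷ f ∷ t ∷ []) ∷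
  (t ∷ f ∷ t ∷ f ∷ t ∷ t ∷ f ∷ f ∷ []) ∷
  (f ∷ t ∷ f ∷ t ∷ f ∷ t ∷ t ∷ f ∷ []) ∷
  (t ∷ f ∷ t ∷ f ∷ f ∷ f ∷ t ∷ t ∷ []) ∷
  (t ∷ t ∷ f ∷ f ∷ f ∷ f ∷ f ∷ f ∷ []) ∷
  (f ∷ t ∷ t ∷ f ∷ f ∷ f ∷ f ∷ f ∷ []) ∷
  (f ∷ f ∷ t ∷ t ∷ f ∷ f ∷ f ∷ f ∷ []) ∷
  (t ∷ f ∷ f ∷ t ∷ f ∷ f ∷ f ∷ f ∷ []) ∷ []
  where
    t = true
    f = false

L : Fin 8 → Fin 8 → Bool
L a b = lookup (lookup gadget a) b

L-sym : ∀ a b → T (L a b) → T (L b a)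
L-sym = toWitness {a? = Fin.all? λ a → Fin.all? λ b → T? (L a b) →-dec T? (L b a)} tt

L-irr : ∀ a → ¬ T (L a a)
L-irr = toWitness {a? = Fin.all? λ a → ¬? (T? (L a a))} tt

port : Fin 8 → Bool
port 5F = true
port 7F = true
port _  = false

any : ∀ {n} → (Fin n → Bool) → Bool
any = foldr _∨_ false

any⁻ : ∀ {n} (p : Fin n → Bool) → T (any p) → ∃ λ i → T (p i)
any⁻ {suc n} p t with Equivalence.to (T-∨ {p zero}) t
... | inj₁ t₀ = zero , t₀
... | inj₂ t′ with any⁻ (p ∘ suc) t′
...   | i , tᵢ = suc i , tᵢ

T-not : ∀ {b} → ¬ T b → T (not b)
T-not {false} _ = tt
T-not {true}  h = ⊥-elim (h tt)

not-T : ∀ {b} → T (not b) → ¬ T b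
not-T {false} _ ()

∀-vec? : ∀ n → (Vec Bool n → Bool) → Bool
∀-vec? zero    p = p []
∀-vec? (suc n) p = ∀-vec? n (p ∘ (true ∷_)) ∧ ∀-vec? n (p ∘ (false ∷_))

∀-vec : ∀ {n} p → T (∀-vec? n p) → ∀ y → T (p y)
∀-vec p t []          = t
∀-vec p t (true ∷ y)  = ∀-vec (p ∘ (true ∷_)) (proj₁ (Equivalence.to T-∧ t)) y
∀-vec p t (false ∷ y) = ∀-vec (p ∘ (false ∷_)) (proj₂ (Equivalence.to (T-∧ {∀-vec? _ (p ∘ (true ∷_))}) t)) y

module Search {n} (adj : Fin n → Fin n → Bool) (goal : Fin n → Bool) where

  grown : Vec Bool n → Vec Bool n → Fin n → Bool
  grown y d b = lookup d b ∨ (not (lookup y b) ∧ any λ c → lookup d c ∧ adj c b)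

  expand : Vec Bool n → Vec Bool n → Vec Bool n
  expand y d = tabulate (grown y d)

  single : Fin n → Vec Bool n
  single a = tabulate λ b → does (a ≟ᶠ b)

  -- Three rounds of breadth-first search from a, avoiding y; this suffices
  -- for the gadget.
  ball : Vec Bool n → Fin n → Vec Bool n
  ball y a = expand y (expand y (expand y (single a)))

  escapes : Vec Bool n → Fin n → Fin n → Bool
  escapes y a b = lookup (ball y a) b ∧ (goal b ∨ (toℕ b <ᵇ toℕ a))

  -- The least vertex of each component that contains no goal, once `y` is deleted. A ball that is
  -- too small can only make more vertices blocked, so counting blocked vertices always bounds the
  -- number of such components from above.
  blocked : Vec Bool n → Fin n → Bool
  blocked y a = not (lookup y a) ∧ not (any (escapes y a))

  module _ {R : Fin n → Fin n → Set} (y : Vec Bool n)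
    (edge : ∀ {b c} → ¬ T (lookup y b) → ¬ T (lookup y c) → T (adj b c) → R b c) where

    private
      Sound : Fin n → Vec Bool n → Set
      Sound a d = ∀ b → T (lookup d b) → ¬ T (lookup y b) × Star R a b

    expand-sound : ∀ {a} d → Sound a d → Sound a (expand y d)
    expand-sound d sound b t
      with Equivalence.to (T-∨ {lookup d b}) (subst T (lookup∘tabulate (grown y d) b) t)
    ... | inj₁ old = sound b old
    ... | inj₂ new with Equivalence.to (T-∧ {not (lookup y b)}) new
    ...   | b∉y , hit with any⁻ _ hit
    ...     | c , cb with Equivalence.to (T-∧ {lookup d c}) cb
    ...       | c∈d , c~b with sound c c∈d
    ...         | c∉y , r = not-T b∉y , r ◅◅ (edge c∉y (not-T b∉y) c~b ◅ ε)

    ball-sound : ∀ {a} → ¬ T (lookup y a) → ∀ b → T (lookup (ball y a) b) → Star R a b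
    ball-sound {a} a∉y b t = proj₂ (expand-sound (expand y (expand y (single a)))
      (expand-sound (expand y (single a)) (expand-sound (single a) start)) b t)
      where
        start : Sound a (single a)
        start c t with a ≟ᶠ c | subst T (lookup∘tabulate (λ b → does (a ≟ᶠ b)) c) t
        ... | yes refl | _ = a∉y , ε

    -- Any escape found by the search is a genuine walk that avoids `y`, by soundness of the ball,
    -- and so contradicts the assumption on `a`.
    blocked⁺ : ∀ {a} → ¬ T (lookup y a) → (∀ b → Star R a b → ¬ T (goal b) × toℕ a ≤ toℕ b) → T (blocked y a)
    blocked⁺ {a} a∉y trapped = Equivalence.from T-∧ (T-not a∉y , T-not none)
      where
        none : ¬ T (any (escapes y a))
        none t with any⁻ (escapes y a) t
        ... | b , tb with Equivalence.to (T-∧ {lookup (ball y a) b}) tb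
        ...   | reached , tb′ with trapped b (ball-sound a∉y b reached) | Equivalence.to (T-∨ {goal b}) tb′
        ...     | ¬goal , _ | inj₁ g = ¬goal g
        ...     | _ , a≤b   | inj₂ l = <⇒≱ (<ᵇ⇒< (toℕ b) (toℕ a) l) a≤b

open Search L port using (blocked; blocked⁺)

∀-bounds : ∀ {n} (f g : Vec Bool n → ℕ) → ∀-vec? n (λ y → (2 · f y ≤ᵇ g y) ∧ (f y ≤ᵇ 2)) ≡ true →
  ∀ y → 2 · f y ≤ g y × f y ≤ 2
∀-bounds f g checked y with Equivalence.to (T-∧ {2 · f y ≤ᵇ g y}) (∀-vec _ (Equivalence.from T-≡ checked) y)
... | s , t = ≤ᵇ⇒≤ _ _ s , ≤ᵇ⇒≤ _ _ t

-- All 256 sets of deleted gadget vertices are checked by evaluation, which is why `refl` suffices.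
-- The first bound charges two deletions to each component cut off from the ports.
blocked-bounds : ∀ y → 2 · # (blocked y) ≤ # (lookup y) × # (blocked y) ≤ 2
blocked-bounds = ∀-bounds (λ y → # (blocked y)) (λ y → # (lookup y)) refl

-- The graph.

module Construction (m l w N : ℕ) where

  data Vtx : Set where
    hub : Fin m → Vtx
    gad : Fin l → Fin 8 → Vtx
    ext : Fin w → Vtx
    far : Fin N → Vtx

  n : ℕ
  n = m + (l · 8 + (w + N))

  -- The eight vertices of a gadget receive consecutive numbers in their own order, so that a least
  -- vertex of a component is also least within its gadget.
  enc : Vtx → Fin n
  enc (hub h)   = h ↑ˡ (l · 8 + (w + N))
  enc (gad i a) = m ↑ʳ (combine i a ↑ˡ (w + N))
  enc (ext e)   = m ↑ʳ (l · 8 ↑ʳ (e ↑ˡ N))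
  enc (far f)   = m ↑ʳ (l · 8 ↑ʳ (w ↑ʳ f))

  dec₃ : Fin (w + N) → Vtx
  dec₃ v = [ ext , far ]′ (splitAt w v)

  dec₂ : Fin (l · 8 + (w + N)) → Vtx
  dec₂ v = [ uncurry gad ∘ remQuot {l} 8 , dec₃ ]′ (splitAt (l · 8) v)

  dec : Fin n → Vtx
  dec v = [ hub , dec₂ ]′ (splitAt m v)

  dec-enc : ∀ x → dec (enc x) ≡ x
  dec-enc (hub h) rewrite Fin.splitAt-↑ˡ m h (l · 8 + (w + N)) = refl
  dec-enc (gad i a)
    rewrite Fin.splitAt-↑ʳ m (l · 8 + (w + N)) (combine i a ↑ˡ (w + N))
          | Fin.splitAt-↑ˡ (l · 8) (combine i a) (w + N)
    = cong (uncurry gad) (Fin.remQuot-combine {l} {8} i a)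
  dec-enc (ext e)
    rewrite Fin.splitAt-↑ʳ m (l · 8 + (w + N)) (l · 8 ↑ʳ (e ↑ˡ N))
          | Fin.splitAt-↑ʳ (l · 8) (w + N) (e ↑ˡ N)
          | Fin.splitAt-↑ˡ w e N = refl
  dec-enc (far f)
    rewrite Fin.splitAt-↑ʳ m (l · 8 + (w + N)) (l · 8 ↑ʳ (w ↑ʳ f))
          | Fin.splitAt-↑ʳ (l · 8) (w + N) (w ↑ʳ f)
          | Fin.splitAt-↑ʳ w N f = refl

  enc-dec : ∀ v → enc (dec v) ≡ v
  enc-dec v with splitAt m v in eq
  ... | inj₁ h = Fin.splitAt⁻¹-↑ˡ eq
  ... | inj₂ v₂ with splitAt (l · 8) v₂ in eq₂
  ...   | inj₁ c = trans (cong (λ d → m ↑ʳ (d ↑ˡ (w + N))) (Fin.combine-remQuot {l} 8 c))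
                     (trans (cong (m ↑ʳ_) (Fin.splitAt⁻¹-↑ˡ eq₂)) (Fin.splitAt⁻¹-↑ʳ eq))
  ...   | inj₂ v₃ with splitAt w v₃ in eq₃
  ...     | inj₁ e = trans (cong (λ d → m ↑ʳ (l · 8 ↑ʳ d)) (Fin.splitAt⁻¹-↑ˡ eq₃))
                       (trans (cong (m ↑ʳ_) (Fin.splitAt⁻¹-↑ʳ eq₂)) (Fin.splitAt⁻¹-↑ʳ eq))
  ...     | inj₂ f = trans (cong (λ d → m ↑ʳ (l · 8 ↑ʳ d)) (Fin.splitAt⁻¹-↑ʳ eq₃))
                       (trans (cong (m ↑ʳ_) (Fin.splitAt⁻¹-↑ʳ eq₂)) (Fin.splitAt⁻¹-↑ʳ eq))

  dec-injective : ∀ {u v} → dec u ≡ dec v → u ≡ v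
  dec-injective {u} {v} eq = trans (sym (enc-dec u)) (trans (cong enc eq) (enc-dec v))

  sum-enc : ∀ f → sum f ≡ sum (f ∘ enc ∘ hub) +
    (sum (λ i → sum (λ a → f (enc (gad i a)))) + (sum (f ∘ enc ∘ ext) + sum (f ∘ enc ∘ far)))
  sum-enc f = trans (sum-↑ m f) (cong (sum (f ∘ enc ∘ hub) +_)
    (trans (sum-↑ (l · 8) (f ∘ (m ↑ʳ_))) (cong₂ _+_ (sum-combine l (λ c → f (m ↑ʳ (c ↑ˡ (w + N)))))
      (sum-↑ w (λ v → f (m ↑ʳ (l · 8 ↑ʳ v)))))))

  E : Vtx → Vtx → Set
  E (hub h)   (hub h′)   = h ≢ h′
  E (hub _)   (far _)    = ⊥
  E (hub _)   _          = ⊤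
  E (gad _ _) (hub _)    = ⊤
  E (gad i a) (gad j b)  = (i ≡ j × T (L a b)) ⊎ (T (port a) × T (port b) × (i , a) ≢ (j , b))
  E (gad _ a) (ext _)    = T (port a)
  E (gad _ _) (far _)    = ⊥
  E (ext _)   (hub _)    = ⊤
  E (ext _)   (gad _ a)  = T (port a)
  E (ext e)   (ext e′)   = e ≢ e′
  E (ext _)   (far _)    = ⊥
  E (far f)   (far f′)   = f ≢ f′
  E (far _)   _          = ⊥

  E? : ∀ x y → Dec (E x y)
  E? (hub h)   (hub h′)  = ¬? (h ≟ᶠ h′)
  E? (hub _)   (gad _ _) = yes tt
  E? (hub _)   (ext _)   = yes tt
  E? (hub _)   (far _)   = no λ ()
  E? (gad _ _) (hub _)   = yes tt
  E? (gad i a) (gad j b) = (i ≟ᶠ j ×-dec T? (L a b)) ⊎-dec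
    (T? (port a) ×-dec T? (port b) ×-dec ¬? (≡-dec _≟ᶠ_ _≟ᶠ_ (i , a) (j , b)))
  E? (gad _ a) (ext _)   = T? (port a)
  E? (gad _ _) (far _)   = no λ ()
  E? (ext _)   (hub _)   = yes tt
  E? (ext _)   (gad _ a) = T? (port a)
  E? (ext e)   (ext e′)  = ¬? (e ≟ᶠ e′)
  E? (ext _)   (far _)   = no λ ()
  E? (far _)   (hub _)   = no λ ()
  E? (far _)   (gad _ _) = no λ ()
  E? (far _)   (ext _)   = no λ ()
  E? (far f)   (far f′)  = ¬? (f ≟ᶠ f′)

  E-sym : ∀ x y → E x y → E y x
  E-sym (hub _)   (hub _)   e = e ∘ sym
  E-sym (hub _)   (gad _ _) e = tt
  E-sym (hub _)   (ext _)   e = tt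
  E-sym (gad _ _) (hub _)   e = tt
  E-sym (gad i a) (gad j b) (inj₁ (i≡j , e)) = inj₁ (sym i≡j , L-sym a b e)
  E-sym (gad i a) (gad j b) (inj₂ (p , q , ne)) = inj₂ (q , p , ne ∘ sym)
  E-sym (gad _ _) (ext _)   e = e
  E-sym (ext _)   (hub _)   e = tt
  E-sym (ext _)   (gad _ _) e = e
  E-sym (ext _)   (ext _)   e = e ∘ sym
  E-sym (far _)   (far _)   e = e ∘ sym

  E-irr : ∀ x → ¬ E x x
  E-irr (hub h)   e = e refl
  E-irr (gad i a) (inj₁ (_ , e))      = L-irr a e
  E-irr (gad i a) (inj₂ (_ , _ , ne)) = ne refl
  E-irr (ext e)   ne = ne refl
  E-irr (far f)   ne = ne refl

  G : Graph n
  G = record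
    { V     = full
    ; _~_   = λ u v → E (dec u) (dec v)
    ; _~?_  = λ u v → E? (dec u) (dec v)
    ; ~-sym = λ {u} {v} → E-sym (dec u) (dec v)
    ; ~-irr = λ {u} → E-irr (dec u)
    ; ~⇒∈   = λ _ → ∈⊤
    }

  core : Vtx → Bool
  core (far _) = false
  core _       = true

  -- The port clique, formed by the ports of all gadgets and the `ext` vertices.
  central : Vtx → Bool
  central (gad _ a) = port a
  central (ext _)   = true
  central _         = false

  E-hub : ∀ h x → T (core x) → x ≢ hub h → E x (hub h)
  E-hub h (hub h′)  _ ne = ne ∘ cong hub
  E-hub h (gad _ _) _ _  = tt
  E-hub h (ext _)   _ _  = tt

  E-central : ∀ x y → T (central x) → T (central y) → x ≢ y → E x y
  E-central (gad i a) (gad j b) p q ne = inj₂ (p , q , λ { refl → ne refl })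
  E-central (gad _ _) (ext _)   p _ _  = p
  E-central (ext _)   (gad _ _) _ q _  = q
  E-central (ext _)   (ext _)   _ _ ne = ne ∘ cong ext

  E-far : ∀ x y → T (not (core x)) → T (not (core y)) → x ≢ y → E x y
  E-far (far _) (far _) _ _ ne = ne ∘ cong far

  #core : # (core ∘ dec) ≡ m + (l · 8 + w)
  #core = trans (sum-enc (λ v → ⟦ core (dec v) ⟧)) (cong₂ _+_ (ones (λ h → hub h) (λ _ → refl))
    (cong₂ _+_ (trans (sum-cong-≗ (λ i → ones (gad i) (λ _ → refl))) (sum-const l 8))
      (trans (cong₂ _+_ (ones ext (λ _ → refl)) zeros) (+-identityʳ w))))
    where
      ones : ∀ {r} (f : Fin r → Vtx) → (∀ i → core (f i) ≡ true) → sum (λ i → ⟦ core (dec (enc (f i))) ⟧) ≡ r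
      ones {r} f eq = trans (sum-cong-≗ λ i → cong ⟦_⟧ (trans (cong core (dec-enc (f i))) (eq i)))
        (trans (sum-const r 1) (*-identityʳ r))
      zeros : sum (λ i → ⟦ core (dec (enc (far i))) ⟧) ≡ 0
      zeros = trans (sum-cong-≗ λ i → cong (⟦_⟧ ∘ core) (dec-enc (far i))) (trans (sum-const N 0) (*-zeroʳ N))

  #far≥ : N ≤ # (not ∘ core ∘ dec)
  #far≥ = begin
    N                                      ≡⟨ trans (sum-const N 1) (*-identityʳ N) ⟨
    sum {N} (λ _ → 1)                      ≡⟨ sum-cong-≗ (λ f → cong (⟦_⟧ ∘ not ∘ core) (dec-enc (far f))) ⟨
    F                                      ≤⟨ m≤n+m F (A + (B + C)) ⟩
    A + (B + C) + F                        ≡⟨ trans (+-assoc A (B + C) F) (cong (A +_) (+-assoc B C F)) ⟩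
    A + (B + (C + F))                      ≡⟨ sum-enc f ⟨
    # (not ∘ core ∘ dec)                   ∎
    where
      open ≤-Reasoning
      f = λ v → ⟦ not (core (dec v)) ⟧
      A = sum (f ∘ enc ∘ hub)
      B = sum (λ i → sum (λ a → f (enc (gad i a))))
      C = sum (f ∘ enc ∘ ext)
      F = sum (f ∘ enc ∘ far)

-- Components left by the deletion of a vertex set.

#-split : ∀ {n} (p c : Fin n → Bool) → # p ≡ # (λ v → p v ∧ c v) + # (λ v → p v ∧ not (c v))
#-split p c = trans (sum-cong-≗ λ v → split (p v) (c v)) (∑-distrib-+ (λ v → ⟦ p v ∧ c v ⟧) _)
  where
    split : ∀ a b → ⟦ a ⟧ ≡ ⟦ a ∧ b ⟧ + ⟦ a ∧ not b ⟧
    split false _     = refl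
    split true  true  = refl
    split true  false = refl

-- Each of the `r` further components costs `q` and is paid for by two deletions up to an excess of
-- `q ∸ 2 · p`. This excess is largest in total for `r = S`, where `m` covers it.
ratio-bound : ∀ {p q r m S} → q + S · (q ∸ 2 · p) ≤ p · m → r ≤ S → q · (1 + r) ≤ p · (m + 2 · r)
ratio-bound {p} {q} {r} {m} {S} cond r≤S = begin
  q · (1 + r)                                 ≡⟨ solve 2 (λ q r → q :* (con 1 :+ r) := q :+ r :* q) refl q r ⟩
  q + r · q                                   ≤⟨ +-monoʳ-≤ q (*-monoʳ-≤ r (m≤n+m∸n q (2 · p))) ⟩
  q + r · (2 · p + (q ∸ 2 · p))               ≡⟨ solve 4 (λ q r p d → q :+ r :* (con 2 :* p :+ d) := q :+ r :* d :+ p :* (con 2 :* r)) refl q r p (q ∸ 2 · p) ⟩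
  q + r · (q ∸ 2 · p) + p · (2 · r)           ≤⟨ +-monoˡ-≤ (p · (2 · r)) (+-monoʳ-≤ q (*-monoˡ-≤ (q ∸ 2 · p) r≤S)) ⟩
  q + S · (q ∸ 2 · p) + p · (2 · r)           ≤⟨ +-monoˡ-≤ (p · (2 · r)) cond ⟩
  p · m + p · (2 · r)                         ≡⟨ *-distribˡ-+ p m (2 · r) ⟨
  p · (m + 2 · r)                             ∎
  where
    open ≤-Reasoning
    open +-*-Solver

module Deletion {m l w N : ℕ} (k p q : ℕ) (X : Subset (Construction.n m l w N)) where
  open Construction m l w N

  H : Graph n
  H = G - X

  open Components H

  edge : ∀ {u v} → ¬ u ∈ X → ¬ v ∈ X → E (dec u) (dec v) → _~_ H u v
  edge u∉X v∉X e = e , x∉p⇒x∈∁p u∉X , x∉p⇒x∈∁p v∉X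

  χ x : Fin n → Bool
  χ = lookup (representatives k)
  x = lookup X

  χ⇒rep : ∀ {v} → T (χ v) → Representative k v
  χ⇒rep t = ∈subsetOf⁻ (representative? k) (T⇒∈ (representatives k) t)

  ∈V⇒∉X : ∀ {v} → v ∈ V H → ¬ v ∈ X
  ∈V⇒∉X v∈V = x∈∁p⇒x∉p (proj₂ (x∈p∩q⁻ full (∁ X) v∈V))

  χ⇒∉X : ∀ {v} → T (χ v) → ¬ v ∈ X
  χ⇒∉X t = ∈V⇒∉X (Representative.∈V (χ⇒rep t))

  -- At most one small component is represented in `c`, and it contains all of `c` that survives.
  -- Having fewer than `2 · k` vertices, it leaves at least `s` vertices of `c` to `X`, and these
  -- pay for it.
  connected-bound : ∀ (c : Fin n → Bool) s →
    (∀ {u v} → ¬ u ∈ X → ¬ v ∈ X → T (c u) → T (c v) → Reachable H u v) →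
    2 · k + s ≤ suc (# c) → q ≤ p · s →
    q · # (λ v → χ v ∧ c v) ≤ p · # (λ v → x v ∧ c v)
  connected-bound c s conn big q≤ps with #-search (λ v → χ v ∧ c v)
  ... | inj₂ none = ≤-trans (≤-reflexive (trans (cong (q ·_) none) (*-zeroʳ q))) z≤n
  ... | inj₁ (v , t) = begin
    q · # (λ v → χ v ∧ c v)   ≤⟨ *-monoʳ-≤ q one ⟩
    q · 1                     ≡⟨ *-identityʳ q ⟩
    q                         ≤⟨ q≤ps ⟩
    p · s                     ≤⟨ *-monoʳ-≤ p s≤ ⟩
    p · # (λ v → x v ∧ c v)   ∎
    where
      open ≤-Reasoning
      χv = proj₁ (Equivalence.to (T-∧ {χ v}) t)
      cv = proj₂ (Equivalence.to (T-∧ {χ v}) t)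
      one : # (λ v → χ v ∧ c v) ≤ 1
      one = #-unique λ i j ti tj →
        let χi , ci = Equivalence.to (T-∧ {χ i}) ti ; χj , cj = Equivalence.to (T-∧ {χ j}) tj
        in representative-unique (χ⇒rep χi) (χ⇒rep χj) (conn (χ⇒∉X χi) (χ⇒∉X χj) ci cj)
      inClass : ∀ u → T (c u ∧ not (x u)) → T (lookup (class v) u)
      inClass u tu = let cu , xu = Equivalence.to (T-∧ {c u}) tu in
        ∈⇒T (∈subsetOf⁺ (reachable? H v) (conn (χ⇒∉X χv) (λ u∈X → not-T xu (∈⇒T u∈X)) cv cu))
      swap : # (λ u → c u ∧ x u) ≤ # (λ u → x u ∧ c u)
      swap = #-mono λ u tu → let cu , xu = Equivalence.to (T-∧ {c u}) tu in Equivalence.from T-∧ (xu , cu)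
      s≤ : s ≤ # (λ v → x v ∧ c v)
      s≤ = +-cancelˡ-≤ (2 · k) _ _ (begin
        2 · k + s                                                   ≤⟨ big ⟩
        suc (# c)                                                   ≡⟨ cong suc (#-split c x) ⟩
        suc (# (λ u → c u ∧ x u) + # (λ u → c u ∧ not (x u)))       ≤⟨ s≤s (+-mono-≤ swap (#-mono inClass)) ⟩
        suc (# (λ u → x u ∧ c u) + # (lookup (class v)))            ≡⟨ +-suc _ _ ⟨
        # (λ u → x u ∧ c u) + suc (# (lookup (class v)))            ≡⟨ cong (λ z → # (λ u → x u ∧ c u) + suc z) (∣∣≡# (class v)) ⟨
        # (λ u → x u ∧ c u) + suc ∣ class v ∣                       ≤⟨ +-monoʳ-≤ (# (λ u → x u ∧ c u)) (Representative.small (χ⇒rep χv)) ⟩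
        # (λ u → x u ∧ c u) + 2 · k                                 ≡⟨ +-comm _ (2 · k) ⟩
        2 · k + # (λ u → x u ∧ c u)                                 ∎)

  far-connected : ∀ {u v} → ¬ u ∈ X → ¬ v ∈ X → T (not (core (dec u))) → T (not (core (dec v))) → Reachable H u v
  far-connected {u} {v} u∉X v∉X fu fv with u ≟ᶠ v
  ... | yes refl = ε
  ... | no u≢v   = edge u∉X v∉X (E-far (dec u) (dec v) fu fv (u≢v ∘ dec-injective)) ◅ ε

  to-hub : ∀ {h u} → ¬ enc (hub h) ∈ X → ¬ u ∈ X → T (core (dec u)) → Reachable H u (enc (hub h))
  to-hub {h} {u} h∉X u∉X cu with u ≟ᶠ enc (hub h)
  ... | yes refl = ε
  ... | no u≢h   = edge u∉X h∉X (subst (E (dec u)) (sym (dec-enc (hub h)))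
    (E-hub h (dec u) cu (λ eq → u≢h (trans (sym (enc-dec u)) (cong enc eq))))) ◅ ε

  central-connected : ∀ {u v} → ¬ u ∈ X → ¬ v ∈ X → T (central (dec u)) → T (central (dec v)) → Reachable H u v
  central-connected {u} {v} u∉X v∉X cu cv with u ≟ᶠ v
  ... | yes refl = ε
  ... | no u≢v   = edge u∉X v∉X (E-central (dec u) (dec v) cu cv (u≢v ∘ dec-injective)) ◅ ε

  meetsCentre? : ∀ v → Dec (∃ λ u → Reachable H v u × T (central (dec u)))
  meetsCentre? v = Fin.any? λ u → reachable? H v u ×-dec T? (central (dec u))

  y : Fin l → Vec Bool 8
  y i = tabulate λ a → x (enc (gad i a))

  module _ (hub⊆X : ∀ h → enc (hub h) ∈ X) where

    inner : Fin n → Bool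
    inner v = (χ v ∧ core (dec v)) ∧ not (does (meetsCentre? v))

    inner⁻ : ∀ z → T (inner (enc z)) → T (χ (enc z)) × T (core z) ×
      ¬ (∃ λ u → Reachable H (enc z) u × T (central (dec u)))
    inner⁻ z t with Equivalence.to (T-∧ {χ (enc z) ∧ core (dec (enc z))}) t
    ... | t₁ , t₂ with Equivalence.to (T-∧ {χ (enc z)}) t₁ | meetsCentre? (enc z)
    ...   | χv , cv | no ¬meets = χv , subst (T ∘ core) (dec-enc z) cv , ¬meets

    -- Walks inside the gadget are walks of `H`. From a representative whose component misses the
    -- port clique they reach neither a port nor a vertex of smaller index.
    inner-gad : ∀ i a → T (inner (enc (gad i a))) → T (blocked (y i) a)
    inner-gad i a t with inner⁻ (gad i a) t
    ... | χv , _ , ¬meets = blocked⁺ {R = λ b c → _~_ H (enc (gad i b)) (enc (gad i c))} (y i)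
        link (λ ya → χ⇒∉X χv (y⇒∈X ya)) λ b r →
          let r′ = gmap (λ c → enc (gad i c)) (λ e → e) r in
          (λ pb → ¬meets (enc (gad i b) , r′ , subst (T ∘ central) (sym (dec-enc (gad i b))) pb)) ,
          order (Representative.low (χ⇒rep χv) _ r′)
      where
        y⇒∈X : ∀ {b} → T (lookup (y i) b) → enc (gad i b) ∈ X
        y⇒∈X {b} t = T⇒∈ X (subst T (lookup∘tabulate (λ a → x (enc (gad i a))) b) t)
        ∉y⇒∉X : ∀ {b} → ¬ T (lookup (y i) b) → ¬ enc (gad i b) ∈ X
        ∉y⇒∉X {b} ∉y b∈X = ∉y (subst T (sym (lookup∘tabulate (λ a → x (enc (gad i a))) b)) (∈⇒T b∈X))
        link : ∀ {b c} → ¬ T (lookup (y i) b) → ¬ T (lookup (y i) c) → T (L b c) → _~_ H (enc (gad i b)) (enc (gad i c))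
        link {b} {c} b∉y c∉y bc = edge (∉y⇒∉X b∉y) (∉y⇒∉X c∉y)
          (subst₂ E (sym (dec-enc (gad i b))) (sym (dec-enc (gad i c))) (inj₁ (refl , bc)))
        toℕ-gad : ∀ b → toℕ (enc (gad i b)) ≡ m + (8 · toℕ i + toℕ b)
        toℕ-gad b = trans (Fin.toℕ-↑ʳ m (combine i b ↑ˡ (w + N)))
          (cong (m +_) (trans (Fin.toℕ-↑ˡ (combine i b) (w + N)) (Fin.toℕ-combine i b)))
        order : ∀ {b} → toℕ (enc (gad i a)) ≤ toℕ (enc (gad i b)) → toℕ a ≤ toℕ b
        order {b} le = +-cancelˡ-≤ (8 · toℕ i) _ _ (+-cancelˡ-≤ m _ _ (subst₂ _≤_ (toℕ-gad a) (toℕ-gad b) le))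

    r : Fin l → ℕ
    r i = # (blocked (y i))

    -- Only gadget vertices can be inner: the hubs are deleted, the `ext` vertices are central
    -- themselves, and the `far` vertices lie outside the core.
    #inner≤ : # inner ≤ sum r
    #inner≤ = begin
      # inner                       ≡⟨ sum-enc (λ v → ⟦ inner v ⟧) ⟩
      _                             ≡⟨ cong₂ _+_ (#-none no-hub) (cong (sum (λ i → # (λ a → inner (enc (gad i a)))) +_)
                                         (cong₂ _+_ (#-none no-ext) (#-none no-far))) ⟩
      sum (λ i → # (λ a → inner (enc (gad i a)))) + 0   ≡⟨ +-identityʳ _ ⟩
      sum (λ i → # (λ a → inner (enc (gad i a))))       ≤⟨ sum-mono-≤ (λ i → #-mono (inner-gad i)) ⟩
      sum r                         ∎
      where
        open ≤-Reasoning
        no-hub : ∀ h → ¬ T (inner (enc (hub h)))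
        no-hub h t = χ⇒∉X (proj₁ (inner⁻ (hub h) t)) (hub⊆X h)
        no-ext : ∀ e → ¬ T (inner (enc (ext e)))
        no-ext e t = proj₂ (proj₂ (inner⁻ (ext e) t)) (_ , ε , subst (T ∘ central) (sym (dec-enc (ext e))) tt)
        no-far : ∀ f → ¬ T (inner (enc (far f)))
        no-far f t = proj₁ (proj₂ (inner⁻ (far f) t))

    -- The surviving part of the port clique is connected, so all components that meet it coincide;
    -- this is the summand 1.
    #reps≤ : # (λ v → χ v ∧ core (dec v)) ≤ 1 + sum r
    #reps≤ = ≤-trans (≤-reflexive (#-split (λ v → χ v ∧ core (dec v)) (λ v → does (meetsCentre? v))))
      (+-mono-≤ (#-unique unique) #inner≤)
      where
        χ-meets : ∀ v → T ((χ v ∧ core (dec v)) ∧ does (meetsCentre? v)) →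
          T (χ v) × ∃ λ u → Reachable H v u × T (central (dec u))
        χ-meets v t with Equivalence.to (T-∧ {χ v ∧ core (dec v)}) t
        ... | t₁ , t₂ with meetsCentre? v
        ...   | yes meets = proj₁ (Equivalence.to (T-∧ {χ v}) t₁) , meets
        unique : ∀ i j → T ((χ i ∧ core (dec i)) ∧ does (meetsCentre? i)) →
          T ((χ j ∧ core (dec j)) ∧ does (meetsCentre? j)) → i ≡ j
        unique i j ti tj with χ-meets i ti | χ-meets j tj
        ... | χi , u , i⟶u , cu | χj , v , j⟶v , cv =
          representative-unique (χ⇒rep χi) (χ⇒rep χj) (i⟶u ◅◅ central-connected (survive χi i⟶u) (survive χj j⟶v) cu cv ◅◅ reach-sym j⟶v)
          where
            survive : ∀ {i u} → T (χ i) → Reachable H i u → ¬ u ∈ X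
            survive χi i⟶u = ∈V⇒∉X (reachable-∈V (Representative.∈V (χ⇒rep χi)) i⟶u)

    -- The hubs give `m`, and `blocked-bounds` gives two deleted vertices per blocked vertex in
    -- every gadget. The summands of `ext` and `far` are dropped.
    #deleted≥ : m + 2 · sum r ≤ # (λ v → x v ∧ core (dec v))
    #deleted≥ = begin
      m + 2 · sum r                       ≡⟨ cong₂ _+_ (sym (trans (sum-const m 1) (*-identityʳ m))) (*-distribˡ-sum 2 r) ⟩
      sum {m} (λ _ → 1) + sum (λ i → 2 · r i)     ≤⟨ +-mono-≤ (sum-mono-≤ λ h → ⟦⟧-mono {true} (λ _ → keep (hub h) tt (∈⇒T (hub⊆X h))))
                                               (sum-mono-≤ λ i → ≤-trans (proj₁ (blocked-bounds (y i))) (#-mono λ a t →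
                                                 keep (gad i a) tt (subst T (lookup∘tabulate (λ a → x (enc (gad i a))) a) t))) ⟩
      A + B                               ≤⟨ +-monoʳ-≤ A (m≤m+n B _) ⟩
      A + (B + _)                         ≡⟨ sum-enc (λ v → ⟦ x v ∧ core (dec v) ⟧) ⟨
      # (λ v → x v ∧ core (dec v))        ∎
      where
        open ≤-Reasoning
        A = # (λ h → x (enc (hub h)) ∧ core (dec (enc (hub h))))
        B = sum (λ i → # (λ a → x (enc (gad i a)) ∧ core (dec (enc (gad i a)))))
        keep : ∀ z → T (core z) → T (x (enc z)) → T (x (enc z) ∧ core (dec (enc z)))
        keep z cz xz = Equivalence.from T-∧ (xz , subst (T ∘ core) (sym (dec-enc z)) cz)

    hub-deleted-bound : q + l · 2 · (q ∸ 2 · p) ≤ p · m →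
      q · # (λ v → χ v ∧ core (dec v)) ≤ p · # (λ v → x v ∧ core (dec v))
    hub-deleted-bound cond = begin
      q · # (λ v → χ v ∧ core (dec v))   ≤⟨ *-monoʳ-≤ q #reps≤ ⟩
      -- At most two blocked vertices in each gadget give `S = l · 2`.
      q · (1 + sum r)                    ≤⟨ ratio-bound {p} {q} {m = m} cond (≤-trans (sum-mono-≤ (λ i → proj₂ (blocked-bounds (y i)))) (≤-reflexive (sum-const l 2))) ⟩
      p · (m + 2 · sum r)                ≤⟨ *-monoʳ-≤ p #deleted≥ ⟩
      p · # (λ v → x v ∧ core (dec v))   ∎
      where open ≤-Reasoning

  module _ {t} (order : m + (l · 8 + w) ≡ 2 · k + 1 + 2 · t) (large : 2 · k + 2 ≤ N)
    (hub-cond : q + l · 2 · (q ∸ 2 · p) ≤ p · m) (core-cond : q ≤ p · (2 + 2 · t)) (far-cond : q ≤ p · 3) where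

    -- A surviving hub keeps the core connected, and a core of order `2 · k + 1 + 2 · t` drops below
    -- `2 · k` only after `2 + 2 · t` deletions. Otherwise all hubs are deleted.
    core-bound : q · # (λ v → χ v ∧ core (dec v)) ≤ p · # (λ v → x v ∧ core (dec v))
    core-bound with Fin.any? (λ h → ¬? (enc (hub h) ∈? X))
    ... | yes (h , h∉X) = connected-bound (core ∘ dec) (2 + 2 · t)
            (λ u∉X v∉X cu cv → to-hub h∉X u∉X cu ◅◅ reach-sym (to-hub h∉X v∉X cv))
            (≤-reflexive (sym (trans (cong suc (trans #core order))
              (solve 2 (λ k t → con 1 :+ (con 2 :* k :+ con 1 :+ con 2 :* t) := con 2 :* k :+ (con 2 :+ con 2 :* t)) refl k t)))) core-cond
            where open +-*-Solver
    ... | no hub⊆X = hub-deleted-bound (λ h → decidable-stable (enc (hub h) ∈? X) (λ h∉X → hub⊆X (h , h∉X))) hub-cond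

    -- A clique of order at least `2 · k + 2` drops below `2 · k` only after three deletions.
    far-bound : q · # (λ v → χ v ∧ not (core (dec v))) ≤ p · # (λ v → x v ∧ not (core (dec v)))
    far-bound = connected-bound (not ∘ core ∘ dec) 3 far-connected
      (≤-trans (≤-reflexive (solve 1 (λ k → con 2 :* k :+ con 3 := con 1 :+ (con 2 :* k :+ con 2)) refl k)) (s≤s (≤-trans large #far≥))) far-cond
      where open +-*-Solver

    oddComponents-bound : q · ∑-oddComponents k H ≤ p · ∣ X ∣
    oddComponents-bound = begin
      q · ∑-oddComponents k H        ≤⟨ *-monoʳ-≤ q (∑-oddComponents≤ k) ⟩
      q · ∣ representatives k ∣      ≡⟨ cong (q ·_) (trans (∣∣≡# (representatives k)) (#-split χ (core ∘ dec))) ⟩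
      q · (# χ₁ + # χ₂)              ≡⟨ *-distribˡ-+ q (# χ₁) (# χ₂) ⟩
      q · # χ₁ + q · # χ₂            ≤⟨ +-mono-≤ core-bound far-bound ⟩
      p · # x₁ + p · # x₂            ≡⟨ *-distribˡ-+ p (# x₁) (# x₂) ⟨
      p · (# x₁ + # x₂)              ≡⟨ cong (p ·_) (trans (∣∣≡# X) (#-split x (core ∘ dec))) ⟨
      p · ∣ X ∣                      ∎
      where
        open ≤-Reasoning
        χ₁ χ₂ x₁ x₂ : Fin n → Bool
        χ₁ v = χ v ∧ core (dec v)
        χ₂ v = χ v ∧ not (core (dec v))
        x₁ v = x v ∧ core (dec v)
        x₂ v = x v ∧ not (core (dec v))

-- Path components of a spanning subgraph; involutions and parity.

vertex-≡ : ∀ {n} {H : Graph n} {u v : Vertex H} → proj₁ u ≡ proj₁ v → u ≡ v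
vertex-≡ {u = u , p} {v = _ , q} refl = cong (u ,_) ([]=-irrelevant p q)

record PathThrough {n} (F : Graph n) (x : Fin n) (r : ℕ) : Set where
  field
    at           : Fin r → Fin n
    at-injective : ∀ {i j} → at i ≡ at j → i ≡ j
    at-reachable : ∀ i → Reachable F x (at i)
    position     : ∀ {v} → Reachable F x v → ∃ λ i → at i ≡ v
    consecutive⁺ : ∀ {i j} → _~_ (P r) i j → _~_ F (at i) (at j)
    consecutive⁻ : ∀ {i j} → _~_ F (at i) (at j) → _~_ (P r) i j

  module _ {v} (x⟶v : Reachable F x v) where

    -- Neighbours of a path vertex sit just before or just after it; two distinct ones cannot both
    -- come after.
    lower-neighbour : ∀ {y z} → y ≢ z → _~_ F v y → _~_ F v z →
      ∀ {i} → at i ≡ v → ∃ λ j → toℕ j < toℕ i × (at j ≡ y ⊎ at j ≡ z)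
    lower-neighbour y≢z vy vz {i} refl with position (x⟶v ◅◅ vy ◅ ε) | position (x⟶v ◅◅ vz ◅ ε)
    ... | j , refl | j′ , refl with consecutive⁻ vy | consecutive⁻ vz
    ...   | inj₂ i≡1+j | _           = j , ≤-reflexive (sym i≡1+j) , inj₁ refl
    ...   | inj₁ _     | inj₂ i≡1+j′ = j′ , ≤-reflexive (sym i≡1+j′) , inj₂ refl
    ...   | inj₁ j≡1+i | inj₁ j′≡1+i = ⊥-elim (y≢z (cong at (Fin.toℕ-injective (trans j≡1+i (sym j′≡1+i)))))

  -- Infinite descent on the position: each member of `Z` has a neighbour in `Z` that comes earlier
  -- on the path.
  acyclic : (Z : Fin n → Set) →
    (∀ {v} → Z v → Reachable F x v × ∃₂ λ y z → y ≢ z × _~_ F v y × _~_ F v z × Z y × Z z) →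
    ∀ {v} → ¬ Z v
  acyclic Z two Zv with position (proj₁ (two Zv))
  ... | i , refl = descend (suc (toℕ i)) i ≤-refl Zv
    where
      descend : ∀ b i → toℕ i < b → ¬ Z (at i)
      descend (suc b) i (s≤s i≤b) Zi with two Zi
      ... | x⟶v , y , z , y≢z , vy , vz , Zy , Zz with lower-neighbour x⟶v y≢z vy vz refl
      ...   | j , j<i , inj₁ eq = descend b j (<-≤-trans j<i i≤b) (subst Z (sym eq) Zy)
      ...   | j , j<i , inj₂ eq = descend b j (<-≤-trans j<i i≤b) (subst Z (sym eq) Zz)

neighbour : ∀ {n} {F : Graph n} {x r} → PathThrough F x (suc (suc r)) → ∃ λ y → _~_ F x y
neighbour {F = F} path with PathThrough.position path ε
... | zero  , at≡x = _ , subst (λ v → _~_ F v (PathThrough.at path (suc zero))) at≡x (PathThrough.consecutive⁺ path (inj₁ refl))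
... | suc i , at≡x = _ , subst (λ v → _~_ F v (PathThrough.at path (inject₁ i))) at≡x
        (PathThrough.consecutive⁺ path (inj₂ (cong suc (sym (Fin.toℕ-inject₁ i)))))

neighbour-unique : ∀ {n} {F : Graph n} {x} → PathThrough F x 2 → ∀ {y z} → _~_ F x y → _~_ F x z → y ≡ z
neighbour-unique {F = F} path xy xz
  with PathThrough.position path ε | PathThrough.position path (xy ◅ ε) | PathThrough.position path (xz ◅ ε)
... | i , at≡x | j , refl | j′ , refl = cong (PathThrough.at path) (only i j j′ (adjacent xy) (adjacent xz))
  where
    adjacent : ∀ {j} → _~_ F _ (PathThrough.at path j) → _~_ (P 2) i j
    adjacent e = PathThrough.consecutive⁻ path (subst (λ v → _~_ F v _) (sym at≡x) e)
    only : ∀ i j j′ → _~_ (P 2) i j → _~_ (P 2) i j′ → j ≡ j′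
    only = toWitness {a? = Fin.all? λ i → Fin.all? λ j → Fin.all? λ j′ →
      _~?_ (P 2) i j →-dec (_~?_ (P 2) i j′ →-dec (j ≟ᶠ j′))} tt

module _ {n} (F : Graph n) where
  open Components F

  ≅P⇒PathThrough : ∀ {x r} → x ∈ V F → (F [ class x ]) ≅ P r → PathThrough F x r
  ≅P⇒PathThrough {x} {r} x∈V iso = record
    { at           = at
    ; at-injective = λ eq → cong proj₁ (trans (sym (Inverse.strictlyInverseˡ φ (_ , ∈⊤)))
                       (trans (cong (Inverse.to φ) (vertex-≡ {H = F [ class x ]} eq)) (Inverse.strictlyInverseˡ φ (_ , ∈⊤))))
    ; at-reachable = λ i → ∈subsetOf⁻ (reachable? F x) (at∈class i)
    ; position     = λ {v} x⟶v → let u = v , x∈p∩q⁺ (reachable-∈V x∈V x⟶v , ∈subsetOf⁺ (reachable? F x) x⟶v) in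
                       proj₁ (Inverse.to φ u) , trans (cong (proj₁ ∘ Inverse.from φ) (vertex-≡ {H = P r} refl))
                         (cong proj₁ (Inverse.strictlyInverseʳ φ u))
    ; consecutive⁺ = λ {i} {j} e → proj₁ (Equivalence.from (_≅_.adjacency iso (from i) (from j))
                       (subst₂ (_~_ (P r)) (sym (to-from i)) (sym (to-from j)) e))
    ; consecutive⁻ = λ {i} {j} e → subst₂ (_~_ (P r)) (to-from i) (to-from j)
                       (Equivalence.to (_≅_.adjacency iso (from i) (from j)) (e , at∈class i , at∈class j))
    }
    where
      φ = _≅_.bijection iso
      from : Fin r → Vertex (F [ class x ])
      from i = Inverse.from φ (i , ∈⊤)
      at : Fin r → Fin n
      at i = proj₁ (from i)
      at∈class : ∀ i → at i ∈ class x
      at∈class i = proj₂ (x∈p∩q⁻ (V F) (class x) (proj₂ (from i)))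
      to-from : ∀ i → proj₁ (Inverse.to φ (from i)) ≡ i
      to-from i = cong proj₁ (Inverse.strictlyInverseˡ φ (i , ∈⊤))

-- Inside `c` the orbits of `σ` are pairs, and `a` selects the smaller element of each.
#-even : ∀ {n} (c : Fin n → Bool) (σ : Fin n → Fin n) → (∀ v → σ (σ v) ≡ v) →
  (∀ v → c (σ v) ≡ c v) → (∀ v → T (c v) → σ v ≢ v) → ∃ λ s → # c ≡ 2 · s
#-even c σ invol inv free = # a , (begin
  # c                                    ≡⟨ sum-cong-≗ split ⟩
  sum (λ v → ⟦ a v ⟧ + ⟦ a (σ v) ⟧)      ≡⟨ ∑-distrib-+ (λ v → ⟦ a v ⟧) (λ v → ⟦ a (σ v) ⟧) ⟩
  # a + # (a ∘ σ)                        ≡⟨ cong (# a +_) (sum-permute (λ v → ⟦ a v ⟧) (permutation σ σ invol invol)) ⟨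
  # a + # a                              ≡⟨ cong (# a +_) (+-identityʳ (# a)) ⟨
  2 · # a                                ∎)
  where
    open ≡-Reasoning
    a : Fin _ → Bool
    a v = c v ∧ (toℕ v <ᵇ toℕ (σ v))
    <ᵇ-true : ∀ {i j} → i < j → (i <ᵇ j) ≡ true
    <ᵇ-true i<j = Equivalence.to T-≡ (<⇒<ᵇ i<j)
    <ᵇ-false : ∀ {i j} → j < i → (i <ᵇ j) ≡ false
    <ᵇ-false {i} {j} j<i with i <ᵇ j in eq
    ... | false = refl
    ... | true  = ⊥-elim (<-asym j<i (<ᵇ⇒< i j (Equivalence.from T-≡ eq)))
    split : ∀ v → ⟦ c v ⟧ ≡ ⟦ a v ⟧ + ⟦ a (σ v) ⟧
    split v rewrite inv v | invol v with c v in eq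
    ... | false = refl
    ... | true with <-cmp (toℕ v) (toℕ (σ v))
    ...   | tri< v<σv _ _ rewrite <ᵇ-true v<σv | <ᵇ-false v<σv = refl
    ...   | tri> _ _ σv<v rewrite <ᵇ-true σv<v | <ᵇ-false σv<v = refl
    ...   | tri≈ _ v≡σv _ = ⊥-elim (free v (Equivalence.from T-≡ eq) (sym (Fin.toℕ-injective v≡σv)))

-- Gadget edges with degree two at every inner vertex.

module Cycles (M : Fin 8 → Fin 8 → Set) (M-sym : ∀ {a b} → M a b → M b a) (M⊆L : ∀ {a b} → M a b → T (L a b)) where

  Degree2In : List (Fin 8) → Fin 8 → Set
  Degree2In xs a = ∃₂ λ b c → b ≢ c × M a b × M a c × b ∈ˡ xs × c ∈ˡ xs

  -- A nonempty list in which every vertex has two neighbours from the list. It need not be given in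
  -- cyclic order, since `acyclic` only uses the degrees.
  Cycle : Set
  Cycle = ∃₂ λ a xs → All (Degree2In (a ∷ xs)) (a ∷ xs)

  private
    via : ∀ {xs a} b c → {True (¬? (b ≟ᶠ c) ×-dec ((b ∈ˡ? xs) ×-dec (c ∈ˡ? xs)))} → M a b → M a c → Degree2In xs a
    via {xs} b c {t} mb mc with toWitness {a? = ¬? (b ≟ᶠ c) ×-dec ((b ∈ˡ? xs) ×-dec (c ∈ˡ? xs))} t
    ... | b≢c , b∈ , c∈ = b , c , b≢c , mb , mc , b∈ , c∈

  -- Vertices 4 and 6 force the paths 0-4-1 and 2-6-3; whichever edges
  -- complete the degrees at 0, 1, 2, 3, they close a cycle.
  inner-degree-2⇒cycle : (∀ a → ¬ T (port a) → ∃₂ λ b c → b ≢ c × M a b × M a c) → Cycle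
  inner-degree-2⇒cycle two = close (third 0F 4F (λ ())) (third 1F 4F (λ ())) (third 2F 6F (λ ())) (third 3F 6F (λ ()))
    where
      third : ∀ a e → ¬ T (port a) → ∃ λ d → M a d × d ≢ e
      third a e inner with two a inner
      ... | b , c , b≢c , mb , mc with b ≟ᶠ e
      ...   | no b≢e   = b , mb , b≢e
      ...   | yes refl = c , mc , b≢c ∘ sym

      nbrs₄ : ∀ d → T (L 4F d) → d ≡ 0F ⊎ d ≡ 1F
      nbrs₄ = toWitness {a? = Fin.all? λ d → T? (L 4F d) →-dec ((d ≟ᶠ 0F) ⊎-dec (d ≟ᶠ 1F))} tt
      nbrs₆ : ∀ d → T (L 6F d) → d ≡ 2F ⊎ d ≡ 3F
      nbrs₆ = toWitness {a? = Fin.all? λ d → T? (L 6F d) →-dec ((d ≟ᶠ 2F) ⊎-dec (d ≟ᶠ 3F))} tt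
      nbrs₀ : ∀ d → T (L 0F d) → d ≢ 4F → d ≡ 1F ⊎ d ≡ 3F ⊎ d ≡ 7F
      nbrs₀ = toWitness {a? = Fin.all? λ d → T? (L 0F d) →-dec (¬? (d ≟ᶠ 4F) →-dec ((d ≟ᶠ 1F) ⊎-dec ((d ≟ᶠ 3F) ⊎-dec (d ≟ᶠ 7F))))} tt
      nbrs₁ : ∀ d → T (L 1F d) → d ≢ 4F → d ≡ 0F ⊎ d ≡ 2F ⊎ d ≡ 5F
      nbrs₁ = toWitness {a? = Fin.all? λ d → T? (L 1F d) →-dec (¬? (d ≟ᶠ 4F) →-dec ((d ≟ᶠ 0F) ⊎-dec ((d ≟ᶠ 2F) ⊎-dec (d ≟ᶠ 5F))))} tt
      nbrs₂ : ∀ d → T (L 2F d) → d ≢ 6F → d ≡ 3F ⊎ d ≡ 1F ⊎ d ≡ 5F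
      nbrs₂ = toWitness {a? = Fin.all? λ d → T? (L 2F d) →-dec (¬? (d ≟ᶠ 6F) →-dec ((d ≟ᶠ 3F) ⊎-dec ((d ≟ᶠ 1F) ⊎-dec (d ≟ᶠ 5F))))} tt
      nbrs₃ : ∀ d → T (L 3F d) → d ≢ 6F → d ≡ 2F ⊎ d ≡ 0F ⊎ d ≡ 7F
      nbrs₃ = toWitness {a? = Fin.all? λ d → T? (L 3F d) →-dec (¬? (d ≟ᶠ 6F) →-dec ((d ≟ᶠ 2F) ⊎-dec ((d ≟ᶠ 0F) ⊎-dec (d ≟ᶠ 7F))))} tt

      pair : ∀ {a} e e′ → ¬ T (port a) → (∀ d → T (L a d) → d ≡ e ⊎ d ≡ e′) → M a e × M a e′
      pair {a} e e′ inner only with two a inner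
      ... | b , c , b≢c , mb , mc with only b (M⊆L mb) | only c (M⊆L mc)
      ...   | inj₁ refl | inj₂ refl = mb , mc
      ...   | inj₂ refl | inj₁ refl = mc , mb
      ...   | inj₁ refl | inj₁ refl = ⊥-elim (b≢c refl)
      ...   | inj₂ refl | inj₂ refl = ⊥-elim (b≢c refl)

      m₄₀ = proj₁ (pair 0F 1F (λ ()) nbrs₄)
      m₄₁ = proj₂ (pair 0F 1F (λ ()) nbrs₄)
      m₆₂ = proj₁ (pair 2F 3F (λ ()) nbrs₆)
      m₆₃ = proj₂ (pair 2F 3F (λ ()) nbrs₆)
      m₀₄ = M-sym m₄₀
      m₁₄ = M-sym m₄₁
      m₂₆ = M-sym m₆₂
      m₃₆ = M-sym m₆₃

      triangle₀₁ : M 0F 1F → Cycle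
      triangle₀₁ m = 0F , 1F ∷ 4F ∷ [] , via 1F 4F m m₀₄ ∷ via 0F 4F (M-sym m) m₁₄ ∷ via 0F 1F m₄₀ m₄₁ ∷ []

      triangle₂₃ : M 2F 3F → Cycle
      triangle₂₃ m = 2F , 3F ∷ 6F ∷ [] , via 3F 6F m m₂₆ ∷ via 2F 6F (M-sym m) m₃₆ ∷ via 2F 3F m₆₂ m₆₃ ∷ []

      hexagon : M 0F 3F → M 1F 2F → Cycle
      hexagon m₀₃ m₁₂ = 0F , 1F ∷ 2F ∷ 3F ∷ 4F ∷ 6F ∷ [] ,
        via 3F 4F m₀₃ m₀₄ ∷ via 2F 4F m₁₂ m₁₄ ∷ via 1F 6F (M-sym m₁₂) m₂₆ ∷ via 0F 6F (M-sym m₀₃) m₃₆ ∷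
        via 0F 1F m₄₀ m₄₁ ∷ via 2F 3F m₆₂ m₆₃ ∷ []

      heptagon₅ : M 0F 3F → M 1F 5F → M 2F 5F → Cycle
      heptagon₅ m₀₃ m₁₅ m₂₅ = 0F , 1F ∷ 2F ∷ 3F ∷ 4F ∷ 5F ∷ 6F ∷ [] ,
        via 3F 4F m₀₃ m₀₄ ∷ via 5F 4F m₁₅ m₁₄ ∷ via 5F 6F m₂₅ m₂₆ ∷ via 0F 6F (M-sym m₀₃) m₃₆ ∷
        via 0F 1F m₄₀ m₄₁ ∷ via 1F 2F (M-sym m₁₅) (M-sym m₂₅) ∷ via 2F 3F m₆₂ m₆₃ ∷ []

      heptagon₇ : M 1F 2F → M 0F 7F → M 3F 7F → Cycle
      heptagon₇ m₁₂ m₀₇ m₃₇ = 0F , 1F ∷ 2F ∷ 3F ∷ 4F ∷ 6F ∷ 7F ∷ [] ,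
        via 7F 4F m₀₇ m₀₄ ∷ via 2F 4F m₁₂ m₁₄ ∷ via 1F 6F (M-sym m₁₂) m₂₆ ∷ via 7F 6F m₃₇ m₃₆ ∷
        via 0F 1F m₄₀ m₄₁ ∷ via 2F 3F m₆₂ m₆₃ ∷ via 0F 3F (M-sym m₀₇) (M-sym m₃₇) ∷ []

      octagon : M 0F 7F → M 1F 5F → M 2F 5F → M 3F 7F → Cycle
      octagon m₀₇ m₁₅ m₂₅ m₃₇ = 0F , 1F ∷ 2F ∷ 3F ∷ 4F ∷ 5F ∷ 6F ∷ 7F ∷ [] ,
        via 7F 4F m₀₇ m₀₄ ∷ via 5F 4F m₁₅ m₁₄ ∷ via 5F 6F m₂₅ m₂₆ ∷ via 7F 6F m₃₇ m₃₆ ∷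
        via 0F 1F m₄₀ m₄₁ ∷ via 1F 2F (M-sym m₁₅) (M-sym m₂₅) ∷ via 2F 3F m₆₂ m₆₃ ∷
        via 0F 3F (M-sym m₀₇) (M-sym m₃₇) ∷ []

      -- An edge from 0 to 1 or from 3 to 2 closes a triangle with the apex 4 or 6. Failing that, 0
      -- and 3 are joined directly or through the apex 7. The other side is symmetric, with the apex
      -- 5.
      half₀₃ : (∃ λ d → M 0F d × d ≢ 4F) → (∃ λ d → M 3F d × d ≢ 6F) → Cycle ⊎ M 0F 3F ⊎ (M 0F 7F × M 3F 7F)
      half₀₃ (d , m , d≢) (e , m′ , e≢) with nbrs₀ d (M⊆L m) d≢ | nbrs₃ e (M⊆L m′) e≢
      ... | inj₁ refl        | _                = inj₁ (triangle₀₁ m)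
      ... | inj₂ (inj₁ refl) | _                = inj₂ (inj₁ m)
      ... | inj₂ (inj₂ _)    | inj₁ refl        = inj₁ (triangle₂₃ (M-sym m′))
      ... | inj₂ (inj₂ _)    | inj₂ (inj₁ refl) = inj₂ (inj₁ (M-sym m′))
      ... | inj₂ (inj₂ refl) | inj₂ (inj₂ refl) = inj₂ (inj₂ (m , m′))

      half₁₂ : (∃ λ d → M 1F d × d ≢ 4F) → (∃ λ d → M 2F d × d ≢ 6F) → Cycle ⊎ M 1F 2F ⊎ (M 1F 5F × M 2F 5F)
      half₁₂ (d , m , d≢) (e , m′ , e≢) with nbrs₁ d (M⊆L m) d≢ | nbrs₂ e (M⊆L m′) e≢
      ... | inj₁ refl        | _                = inj₁ (triangle₀₁ (M-sym m))
      ... | inj₂ (inj₁ refl) | _                = inj₂ (inj₁ m)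
      ... | inj₂ (inj₂ _)    | inj₁ refl        = inj₁ (triangle₂₃ m′)
      ... | inj₂ (inj₂ _)    | inj₂ (inj₁ refl) = inj₂ (inj₁ (M-sym m′))
      ... | inj₂ (inj₂ refl) | inj₂ (inj₂ refl) = inj₂ (inj₂ (m , m′))

      close : (∃ λ d → M 0F d × d ≢ 4F) → (∃ λ d → M 1F d × d ≢ 4F) →
        (∃ λ d → M 2F d × d ≢ 6F) → (∃ λ d → M 3F d × d ≢ 6F) → Cycle
      close d₀ d₁ d₂ d₃ with half₀₃ d₀ d₃ | half₁₂ d₁ d₂
      ... | inj₁ cycle               | _                        = cycle
      ... | inj₂ _                   | inj₁ cycle               = cycle
      ... | inj₂ (inj₁ m₀₃)          | inj₂ (inj₁ m₁₂)          = hexagon m₀₃ m₁₂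
      ... | inj₂ (inj₁ m₀₃)          | inj₂ (inj₂ (m₁₅ , m₂₅))  = heptagon₅ m₀₃ m₁₅ m₂₅
      ... | inj₂ (inj₂ (m₀₇ , m₃₇))  | inj₂ (inj₁ m₁₂)          = heptagon₇ m₁₂ m₀₇ m₃₇
      ... | inj₂ (inj₂ (m₀₇ , m₃₇))  | inj₂ (inj₂ (m₁₅ , m₂₅))  = octagon m₀₇ m₁₅ m₂₅ m₃₇

search : ∀ {n} {A B : Fin n → Set} → (∀ i → A i ⊎ B i) → ∃ A ⊎ (∀ i → B i)
search {zero}  f = inj₂ λ ()
search {suc n} f with f zero | search (f ∘ suc)
... | inj₁ a | _            = inj₁ (zero , a)
... | inj₂ _ | inj₁ (i , a) = inj₁ (suc i , a)
... | inj₂ b | inj₂ g       = inj₂ λ { zero → b ; (suc i) → g i }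

-- Absence of a factor.

module NoFactor {m l w N : ℕ} (k t : ℕ) (1≤k : 1 ≤ k) (t≤1 : t ≤ 1)
  (order : m + (l · 8 + w) ≡ 2 · k + 1 + 2 · t) (many : 2 + (t + (m + m)) < l) where
  open Construction m l w N

  E-core : ∀ x y → E x y → core x ≡ core y
  E-core (hub _)   (hub _)   _ = refl
  E-core (hub _)   (gad _ _) _ = refl
  E-core (hub _)   (ext _)   _ = refl
  E-core (gad _ _) (hub _)   _ = refl
  E-core (gad _ _) (gad _ _) _ = refl
  E-core (gad _ _) (ext _)   _ = refl
  E-core (ext _)   (hub _)   _ = refl
  E-core (ext _)   (gad _ _) _ = refl
  E-core (ext _)   (ext _)   _ = refl
  E-core (far _)   (far _)   _ = refl

  E-inner : ∀ {i a} → ¬ T (port a) → ∀ z → E (gad i a) z → (∃ λ h → z ≡ hub h) ⊎ (∃ λ b → z ≡ gad i b × T (L a b))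
  E-inner ¬p (hub h)   _                    = inj₁ (h , refl)
  E-inner ¬p (gad j b) (inj₁ (refl , ab))   = inj₂ (b , refl , ab)
  E-inner ¬p (gad j b) (inj₂ (p , _ , _))   = ⊥-elim (¬p p)
  E-inner ¬p (ext _)   p                    = ⊥-elim (¬p p)

  module _ (F : Graph n) (spanning : V F ≡ V G) (F⊆G : ∀ {u v} → _~_ F u v → _~_ G u v)
    (paths : ∀ C → IsComponent F C → (F [ C ] ≅ P 2) ⊎ (F [ C ] ≅ P (2 · k + 1))) where
    open Components F

    Core : Fin n → Set
    Core v = T (core (dec v))

    ∈V : ∀ v → v ∈ V F
    ∈V v = subst (v ∈_) (sym spanning) ∈⊤

    classify : ∀ x → PathThrough F x 2 ⊎ PathThrough F x (suc (2 · k))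
    classify x with paths (class x) (class-isComponent (∈V x))
    ... | inj₁ iso = inj₁ (≅P⇒PathThrough F (∈V x) iso)
    ... | inj₂ iso = inj₂ (subst (PathThrough F x) (+-comm (2 · k) 1) (≅P⇒PathThrough F (∈V x) iso))

    F-core : ∀ {u v} → _~_ F u v → core (dec u) ≡ core (dec v)
    F-core {u} {v} e = E-core (dec u) (dec v) (F⊆G e)

    reachable-core : ∀ {u v} → Reachable F u v → Core u → Core v
    reachable-core ε       c = c
    reachable-core (e ◅ r) c = reachable-core r (subst T (F-core e) c)

    hasNeighbour : ∀ x → ∃ λ y → _~_ F x y
    hasNeighbour x with classify x
    ... | inj₁ path = neighbour path
    ... | inj₂ path = neighbour (subst (PathThrough F x) eq path)
      where
        eq : suc (2 · k) ≡ suc (suc (2 · k ∸ 1))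
        eq = cong suc (sym (m+[n∸m]≡n (≤-trans 1≤k (m≤m+n k _))))

    -- Pairing each core vertex with its partner would be a fixed-point-free involution on the core,
    -- whose order is odd.
    not-matching : ¬ (∀ x → Core x → PathThrough F x 2)
    not-matching matching = even≢odd s (k + t) (trans (sym #≡2s) (trans #core (trans order
        (solve 2 (λ k t → con 2 :* k :+ con 1 :+ con 2 :* t := con 1 :+ con 2 :* (k :+ t)) refl k t))))
      where
        open +-*-Solver
        -- Vertices outside the core may lie on long paths; fixing them makes `mate` an involution
        -- of all of `Fin n`.
        mate : Fin n → Fin n
        mate x with T? (core (dec x))
        ... | yes _ = proj₁ (hasNeighbour x)
        ... | no _  = x
        mate-edge : ∀ {x} → Core x → _~_ F x (mate x)
        mate-edge {x} c with T? (core (dec x))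
        ... | yes _ = proj₂ (hasNeighbour x)
        ... | no ¬c = ⊥-elim (¬c c)
        mate-far : ∀ {x} → ¬ Core x → mate x ≡ x
        mate-far {x} ¬c with T? (core (dec x))
        ... | yes c = ⊥-elim (¬c c)
        ... | no _  = refl
        mate-core : ∀ x → core (dec (mate x)) ≡ core (dec x)
        mate-core x with T? (core (dec x))
        ... | yes c = sym (F-core (proj₂ (hasNeighbour x)))
        ... | no ¬c = refl
        involutive : ∀ x → mate (mate x) ≡ x
        involutive x = case (T? (core (dec x)))
          where
            case : Dec (Core x) → mate (mate x) ≡ x
            case (no ¬c) = trans (cong mate (mate-far ¬c)) (mate-far ¬c)
            case (yes c) = neighbour-unique (matching (mate x) c′) (mate-edge c′) (~-sym F (mate-edge c))
              where c′ = subst T (sym (mate-core x)) c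
        even = #-even (core ∘ dec) mate involutive mate-core
          (λ v c fixed → ~-irr F (subst (_~_ F v) fixed (mate-edge c)))
        s = proj₁ even
        #≡2s = proj₂ even

    module _ {x₀} (x₀-core : Core x₀) (path : PathThrough F x₀ (suc (2 · k))) where
      open PathThrough path

      -- The path stays in the core and occupies `2 · k + 1` of its `2 · k + 1 + 2 · t` vertices.
      strays≤ : ∀ {xs} → Unique xs → All (λ v → Core v × ¬ Reachable F x₀ v) xs → length xs ≤ 2 · t
      strays≤ {xs} uni stray = +-cancelˡ-≤ (2 · k + 1) _ _ (begin
        2 · k + 1 + length xs                        ≡⟨ +-comm (2 · k + 1) (length xs) ⟩
        length xs + (2 · k + 1)                      ≡⟨ cong (length xs +_) (trans (+-comm (2 · k) 1) (sym (length-tabulate at))) ⟩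
        length xs + length (tabulateˡ at)            ≡⟨ length-++ xs ⟨
        length (xs ++ tabulateˡ at)                  ≤⟨ length≤∣∣ _≡_ (λ { refl refl → refl }) unique inCore ⟩
        ∣ tabulate (core ∘ dec) ∣                    ≡⟨ ∣∣≡# (tabulate (core ∘ dec)) ⟩
        # (lookup (tabulate (core ∘ dec)))           ≡⟨ sum-cong-≗ (λ v → cong ⟦_⟧ (lookup∘tabulate (core ∘ dec) v)) ⟩
        # (core ∘ dec)                               ≡⟨ trans #core order ⟩
        2 · k + 1 + 2 · t                            ∎)
        where
          open ≤-Reasoning
          disjoint : ∀ {v} → ¬ (v ∈ˡ xs × v ∈ˡ tabulateˡ at)
          disjoint (v∈xs , v∈at) with ∈-tabulate⁻ {f = at} v∈at
          ... | i , refl = proj₂ (All.lookup stray v∈xs) (at-reachable i)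
          unique : Unique (xs ++ tabulateˡ at)
          unique = Unique.++⁺ uni (Unique.tabulate⁺ at-injective) disjoint
          member : ∀ {v} → Core v → ∃ λ u → u ∈ tabulate (core ∘ dec) × v ≡ u
          member {v} c = v , T⇒∈ (tabulate (core ∘ dec)) (subst T (sym (lookup∘tabulate (core ∘ dec) v)) c) , refl
          inCore : All (λ v → ∃ λ u → u ∈ tabulate (core ∘ dec) × v ≡ u) (xs ++ tabulateˡ at)
          inCore = All.++⁺ (All.map (member ∘ proj₁) stray)
            (All.tabulate⁺ (λ i → member (reachable-core (at-reachable i) x₀-core)))

      Inner : Fin l → Fin n → Set
      Inner i v = ∃ λ a → ¬ T (port a) × v ≡ enc (gad i a)

      Inner-unique : ∀ {i j v} → Inner i v → Inner j v → i ≡ j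
      Inner-unique {i} {j} (a , _ , refl) (b , _ , eq)
        with trans (sym (dec-enc (gad i a))) (trans (cong dec eq) (dec-enc (gad j b)))
      ... | refl = refl

      Inner-core : ∀ {i v} → Inner i v → Core v
      Inner-core {i} (a , _ , refl) = subst (T ∘ core) (sym (dec-enc (gad i a))) tt

      Inner-edge : ∀ {i j u v} → Inner i u → Inner j v → _~_ F u v → i ≡ j
      Inner-edge {i} {j} (a , ¬p , refl) (b , _ , refl) e
        with E-inner ¬p (gad j b) (subst₂ E (dec-enc (gad i a)) (dec-enc (gad j b)) (F⊆G e))
      ... | inj₁ (_ , ())
      ... | inj₂ (_ , refl , _) = refl

      -- Labels for what can happen at an inner vertex: it is an end of the path, is missed by the
      -- path, follows a hub or precedes a hub. `Fin t` has at most one element, and for `t = 0` no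
      -- core vertex is missed.
      Code : Set
      Code = Fin 2 ⊎ (Fin t ⊎ (Fin m ⊎ Fin m))

      encode : Code → Fin (2 + (t + (m + m)))
      encode = join 2 (t + (m + m)) ∘ map₂ (join t (m + m) ∘ map₂ (join m m))

      decode : Fin (2 + (t + (m + m))) → Code
      decode = map₂ (map₂ (splitAt m) ∘ splitAt t) ∘ splitAt 2

      decode-encode : ∀ c → decode (encode c) ≡ c
      decode-encode (inj₁ e) = cong (map₂ _) (Fin.splitAt-join 2 (t + (m + m)) (inj₁ e))
      decode-encode (inj₂ (inj₁ s)) = cong (inj₂ ∘ map₂ (splitAt m)) (Fin.splitAt-join t (m + m) (inj₁ s))
      decode-encode (inj₂ (inj₂ h)) =
        trans (cong (inj₂ ∘ map₂ (splitAt m)) (Fin.splitAt-join t (m + m) (inj₂ (join m m h))))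
          (cong (inj₂ ∘ inj₂) (Fin.splitAt-join m m h))

      Event : Fin l → Code → Set
      Event i (inj₁ zero)             = Inner i (at zero)
      Event i (inj₁ (suc _))          = Inner i (at (opposite zero))
      Event i (inj₂ (inj₁ _))         = ∃ λ v → Inner i v × ¬ Reachable F x₀ v
      Event i (inj₂ (inj₂ (inj₁ h)))  = ∃₂ λ p q → toℕ q ≡ suc (toℕ p) × at p ≡ enc (hub h) × Inner i (at q)
      Event i (inj₂ (inj₂ (inj₂ h)))  = ∃₂ λ p q → toℕ q ≡ suc (toℕ p) × at q ≡ enc (hub h) × Inner i (at p)

      -- The path has one vertex at each end and visits a hub only once, so these labels fix the
      -- inner vertex and thereby the gadget. For missed vertices the gadget is fixed by counting.
      event-unique : ∀ {i j} c → Event i c → Event j c → i ≡ j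
      event-unique (inj₁ zero)    e e′ = Inner-unique e e′
      event-unique (inj₁ (suc _)) e e′ = Inner-unique e e′
      event-unique (inj₂ (inj₁ _)) (v , v-inner , v-stray) (v′ , v′-inner , v′-stray)
        with hasNeighbour v
      ... | y , vy with v ≟ᶠ v′ | y ≟ᶠ v′
      ...   | yes refl | _        = Inner-unique v-inner v′-inner
      ...   | no _     | yes refl = Inner-edge v-inner v′-inner vy
      -- `v`, its neighbour `y` in the factor and `v′` would be three missed core vertices, while
      -- there are at most `2 · t ≤ 2`.
      ...   | no v≢v′  | no y≢v′  = ⊥-elim (<⇒≱ (s≤s (*-monoʳ-≤ 2 t≤1)) (strays≤
                (((λ { refl → ~-irr F vy }) ∷ v≢v′ ∷ []) ∷ (y≢v′ ∷ []) ∷ [] ∷ [])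
                ((Inner-core v-inner , v-stray) ∷
                 (subst T (F-core vy) (Inner-core v-inner) , λ r → v-stray (r ◅◅ ~-sym F vy ◅ ε)) ∷
                 (Inner-core v′-inner , v′-stray) ∷ [])))
      event-unique (inj₂ (inj₂ (inj₁ h))) (p , q , next , p-hub , e) (p′ , q′ , next′ , p′-hub , e′)
        with at-injective (trans p-hub (sym p′-hub))
      ... | refl with Fin.toℕ-injective (trans next (sym next′))
      ...   | refl = Inner-unique e e′
      event-unique (inj₂ (inj₂ (inj₂ h))) (p , q , next , q-hub , e) (p′ , q′ , next′ , q′-hub , e′)
        with at-injective (trans q-hub (sym q′-hub))
      ... | refl with Fin.toℕ-injective (suc-injective (trans (sym next) next′))
      ...   | refl = Inner-unique e e′

      module _ (i : Fin l) where

        M : Fin 8 → Fin 8 → Set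
        M a b = _~_ F (enc (gad i a)) (enc (gad i b)) × T (L a b)

        M-sym : ∀ {a b} → M a b → M b a
        M-sym {a} {b} (e , ab) = ~-sym F e , L-sym a b ab

        open Cycles M M-sym proj₂

        Degree2 : Fin 8 → Set
        Degree2 a = ∃₂ λ b c → b ≢ c × M a b × M a c

        Good : Fin 8 → Set
        Good a = Reachable F x₀ (enc (gad i a)) × Degree2 a

        module _ {a} (¬p : ¬ T (port a)) where

          hub-or-gadget : ∀ {v} → _~_ F (enc (gad i a)) v → (∃ λ h → v ≡ enc (hub h)) ⊎ (∃ λ b → v ≡ enc (gad i b) × M a b)
          hub-or-gadget {v} e with E-inner ¬p (dec v) (subst (λ z → E z (dec v)) (dec-enc (gad i a)) (F⊆G e))
          ... | inj₁ (h , eq)      = inj₁ (h , trans (sym (enc-dec v)) (cong enc eq))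
          ... | inj₂ (b , eq , ab) = inj₂ (b , v≡ , subst (_~_ F _) v≡ e , ab)
            where v≡ = trans (sym (enc-dec v)) (cong enc eq)

          -- The vertices before and after an inner vertex on the path are hubs or belong to its
          -- gadget. If neither is a hub, they are two distinct gadget neighbours.
          middle : ∀ {p q r} → toℕ q ≡ suc (toℕ p) → toℕ r ≡ suc (toℕ q) → at q ≡ enc (gad i a) → ∃ (Event i) ⊎ Good a
          middle {p} {q} {r} pq qr eq
            with hub-or-gadget (subst (λ v → _~_ F v (at p)) eq (consecutive⁺ (inj₂ pq)))
               | hub-or-gadget (subst (λ v → _~_ F v (at r)) eq (consecutive⁺ (inj₁ qr)))
          ... | inj₁ (h , p-hub) | _ = inj₁ (inj₂ (inj₂ (inj₁ h)) , p , q , pq , p-hub , a , ¬p , eq)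
          ... | inj₂ _ | inj₁ (h , r-hub) = inj₁ (inj₂ (inj₂ (inj₂ h)) , q , r , qr , r-hub , a , ¬p , eq)
          ... | inj₂ (b , p≡ , ab) | inj₂ (c , r≡ , ac) = inj₂ (subst (Reachable F x₀) eq (at-reachable q) , b , c , b≢c , ab , ac)
            where
              b≢c : b ≢ c
              b≢c refl = <⇒≢ (≤-trans (≤-reflexive (sym pq)) (≤-trans (n≤1+n _) (≤-reflexive (sym qr))))
                (cong toℕ (at-injective (trans p≡ (sym r≡))))

          -- An inner vertex is missed, first, last or interior on the path; the interior case is
          -- left to `middle`. A missed vertex forces `t` to be positive, so that its label exists.
          event-or-degree2 : ∃ (Event i) ⊎ Good a
          event-or-degree2 with reachable? F x₀ (enc (gad i a))
          ... | no stray = inj₁ (inj₂ (inj₁ (fromℕ< 1≤t)) , _ , inner , stray)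
            where
              inner : Inner i (enc (gad i a))
              inner = a , ¬p , refl
              1≤t : 1 ≤ t
              1≤t = positive t (strays≤ ([] ∷ []) ((Inner-core inner , stray) ∷ []))
                where
                  positive : ∀ t → 1 ≤ 2 · t → 1 ≤ t
                  positive (suc _) _ = s≤s z≤n
          ... | yes x₀⟶ with position x₀⟶
          ...   | zero , eq  = inj₁ (inj₁ zero , a , ¬p , eq)
          ...   | suc p , eq with suc (toℕ p) ≟ 2 · k
          -- Of the `2 · k + 1` positions the last is `2 · k`, which is `opposite zero`.
          ...     | yes p≡end = inj₁ (inj₁ (suc zero) , a , ¬p ,
                      trans (cong at (Fin.toℕ-injective (trans (Fin.opposite-prop {suc (2 · k)} zero) (sym p≡end)))) eq)
          ...     | no p≢end = middle (cong suc (sym (Fin.toℕ-inject₁ p))) (Fin.toℕ-fromℕ< p<end) eq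
            where
              p<end : suc (toℕ (suc p)) < suc (2 · k)
              p<end = s≤s (≤∧≢⇒< (≤-pred (Fin.toℕ<n (suc p))) p≢end)

        port-independent : ∀ a b → T (port a) → T (L a b) → ¬ T (port b)
        port-independent = toWitness {a? = Fin.all? λ a → Fin.all? λ b → T? (port a) →-dec (T? (L a b) →-dec ¬? (T? (port b)))} tt

        -- The vertices of the list would form a set on the path in which everyone has two
        -- neighbours, against `acyclic`.
        no-cycle : (∀ a → ¬ T (port a) → Good a) → ¬ Cycle
        no-cycle good (a₀ , xs , cycle) = acyclic Z step (a₀ , here refl , refl)
          where
            Z : Fin n → Set
            Z v = ∃ λ a → a ∈ˡ (a₀ ∷ xs) × v ≡ enc (gad i a)
            reached : ∀ {a} → Degree2In (a₀ ∷ xs) a → Reachable F x₀ (enc (gad i a))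
            reached {a} (b , _ , _ , (ab , lab) , _) with T? (port a)
            ... | no ¬p = proj₁ (good a ¬p)
            -- The hypothesis speaks of inner vertices only. A port is reached through its neighbour
            -- `b`, which is inner because the two ports of a gadget are not adjacent by gadget
            -- edges.
            ... | yes p = proj₁ (good b (port-independent a b p lab)) ◅◅ ~-sym F ab ◅ ε
            gad-injective : ∀ {a b} → enc (gad i a) ≡ enc (gad i b) → a ≡ b
            gad-injective {a} {b} eq with trans (sym (dec-enc (gad i a))) (trans (cong dec eq) (dec-enc (gad i b)))
            ... | refl = refl
            step : ∀ {v} → Z v → Reachable F x₀ v × ∃₂ λ y z → y ≢ z × _~_ F v y × _~_ F v z × Z y × Z z
            step (a , a∈ , refl) with All.lookup cycle a∈
            ... | d@(b , c , b≢c , (ab , _) , (ac , _) , b∈ , c∈) =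
              reached d , _ , _ , b≢c ∘ gad-injective , ab , ac , (b , b∈ , refl) , (c , c∈ , refl)

        event : ∃ (Event i)
        event with search {8} {λ _ → ∃ (Event i)} {λ a → ¬ T (port a) → Good a} attempt
          where
            attempt : ∀ a → ∃ (Event i) ⊎ (¬ T (port a) → Good a)
            attempt a with T? (port a)
            ... | yes p = inj₂ (λ ¬p → ⊥-elim (¬p p))
            ... | no ¬p = map₂ (λ d _ → d) (event-or-degree2 ¬p)
        ... | inj₁ (_ , e) = e
        ... | inj₂ good    = ⊥-elim (no-cycle good (inner-degree-2⇒cycle (λ a ¬p → proj₂ (good a ¬p))))

      too-many-gadgets : ⊥
      too-many-gadgets with Fin.pigeonhole many (encode ∘ proj₁ ∘ event)
      ... | i , j , i<j , same = <⇒≢ i<j (cong toℕ (event-unique (proj₁ (event i)) (proj₂ (event i))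
              (subst (Event j) (sym codes≡) (proj₂ (event j)))))
        where
          codes≡ : proj₁ (event i) ≡ proj₁ (event j)
          codes≡ = trans (sym (decode-encode _)) (trans (cong decode same) (decode-encode _))

    contradiction-from-factor : ⊥
    contradiction-from-factor with search {A = λ x → Core x × PathThrough F x (suc (2 · k))} {B = λ x → Core x → PathThrough F x 2} cases
      where
        cases : ∀ x → (Core x × PathThrough F x (suc (2 · k))) ⊎ (Core x → PathThrough F x 2)
        cases x with classify x | T? (core (dec x))
        ... | inj₁ short | _     = inj₂ (λ _ → short)
        ... | inj₂ _     | no ¬c = inj₂ (λ c → ⊥-elim (¬c c))
        ... | inj₂ long  | yes c = inj₁ (c , long)
    ... | inj₁ (x₀ , c , long) = too-many-gadgets c long
    ... | inj₂ matching        = not-matching matching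

  no-factor : ¬ HasP₂P₂ₖ₊₁Factor k G
  no-factor (F , spanningSubgraph , paths) =
    contradiction-from-factor F (IsSpanningSubgraph.spanning spanningSubgraph) (IsSpanningSubgraph.subgraph spanningSubgraph) paths

-- The rational inequality and the choice of parameters.

≤⇒≤ℚ : ∀ p d s x .{{_ : NonZero d}} → d · s ≤ p · x → fromℕ s ≤ℚ (ℤ.+ p /ℚ d) * fromℕ x
-- Rationals are kept in lowest terms; among unnormalised fractions the inequality is plain cross
-- multiplication.
≤⇒≤ℚ p (suc d) s x le = ℚ.toℚᵘ-cancel-≤ (begin
  toℚᵘ (fromℕ s)                                   ≃⟨ ℚ.toℚᵘ-fromℚᵘ (mkℚᵘ (ℤ.+ s) 0) ⟩
  mkℚᵘ (ℤ.+ s) 0                                   ≤⟨ *≤* (subst₂ ℤ._≤_ lhs rhs (ℤ.+≤+ le)) ⟩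
  mkℚᵘ (ℤ.+ p) d *ᵘ mkℚᵘ (ℤ.+ x) 0                 ≃⟨ ℚᵘ.*-cong (ℚ.toℚᵘ-fromℚᵘ (mkℚᵘ (ℤ.+ p) d)) (ℚ.toℚᵘ-fromℚᵘ (mkℚᵘ (ℤ.+ x) 0)) ⟨
  toℚᵘ (ℤ.+ p /ℚ suc d) *ᵘ toℚᵘ (fromℕ x)          ≃⟨ ℚ.toℚᵘ-homo-* (ℤ.+ p /ℚ suc d) (fromℕ x) ⟨
  toℚᵘ ((ℤ.+ p /ℚ suc d) * fromℕ x)                ∎)
  where
    open ℚᵘ.≤-Reasoning
    lhs : ℤ.+ (suc d · s) ≡ ℤ.+ s ℤ.* ℤ.+ (suc d · 1)
    lhs = trans (cong ℤ.+_ (trans (*-comm (suc d) s) (cong (s ·_) (sym (*-identityʳ (suc d)))))) (ℤ.pos-* s (suc d · 1))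
    rhs : ℤ.+ (p · x) ≡ (ℤ.+ p ℤ.* ℤ.+ x) ℤ.* ℤ.+ 1
    rhs = trans (ℤ.pos-* p x) (sym (ℤ.*-identityʳ _))

-- `hub-cond` is the hypothesis of `ratio-bound` for at most two extra components in each gadget.
-- `core-cond` lets `2 + 2 · t` deletions pay for one component, and `many` leaves more gadgets than
-- labels.
record Parameters (k : ℕ) : Set where
  field
    m l w t   : ℕ
    t≤1       : t ≤ 1
    order     : m + (l · 8 + w) ≡ 2 · k + 1 + 2 · t
    many      : 2 + (t + (m + m)) < l
    hub-cond  : (72 · k ∸ 78) + l · 2 · ((72 · k ∸ 78) ∸ 2 · (32 · k + 141)) ≤ (32 · k + 141) · m
    core-cond : 72 · k ∸ 78 ≤ (32 · k + 141) · (2 + 2 · t)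

-- The coefficient exceeds 32/72, so even 9/4 in place of 3 would do.
far-cond : ∀ k → 72 · k ∸ 78 ≤ (32 · k + 141) · 3
far-cond k = begin
  72 · k ∸ 78                ≤⟨ m∸n≤m (72 · k) 78 ⟩
  72 · k                     ≤⟨ m≤m+n (72 · k) (24 · k + 423) ⟩
  72 · k + (24 · k + 423)    ≡⟨ solve 1 (λ k → con 72 :* k :+ (con 24 :* k :+ con 423) := (con 32 :* k :+ con 141) :* con 3) refl k ⟩
  (32 · k + 141) · 3         ∎
  where
    open ≤-Reasoning
    open +-*-Solver

-- For k ≤ 45 the ratio is at least 1/2, so that two deleted vertices may leave
-- one component of order 2k - 1.
parameters-small : ∀ j → 29 + j ≤ 45 → Parameters (29 + j)
parameters-small j k≤45 = record
  -- Two hubs and `t = 0` allow six labels, hence seven gadgets. Hubs and gadgets have 58 vertices,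
  -- one fewer than the core for `k = 29`; `w` supplies the rest.
  { m = 2 ; l = 7 ; w = 2 · j + 1 ; t = 0
  ; t≤1       = z≤n
  ; order     = solve 1 (λ j → con 2 :+ (con 56 :+ (con 2 :* j :+ con 1)) := con 2 :* (con 29 :+ j) :+ con 1 :+ con 0) refl j
  ; many      = ≤-refl
  -- By `q ≤ 2 · p` the excess per extra component vanishes, and the two hubs pay for the remaining
  -- component.
  ; hub-cond  = ≤-trans (≤-reflexive (trans (cong (λ d → q + 14 · d) (m≤n⇒m∸n≡0 q≤2p)) (+-identityʳ q))) q≤p2
  ; core-cond = q≤p2
  }
  where
    open ≤-Reasoning
    open +-*-Solver
    k = 29 + j
    q = 72 · k ∸ 78
    p = 32 · k + 141
    q≤2p : q ≤ 2 · p
    -- The surplus `8 · k` of `72 · k` over `64 · k` is at most 360 for `k ≤ 45`, and 360 - 78 is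
    -- exactly 2 · 141.
    q≤2p = begin
      72 · k ∸ 78               ≡⟨ cong (_∸ 78) (*-distribʳ-+ k 64 8) ⟩
      64 · k + 8 · k ∸ 78       ≤⟨ ∸-monoˡ-≤ 78 (+-monoʳ-≤ (64 · k) (*-monoʳ-≤ 8 k≤45)) ⟩
      64 · k + 360 ∸ 78         ≡⟨ +-∸-assoc (64 · k) {360} {78} (toWitness {a? = 78 ≤? 360} _) ⟩
      64 · k + 282              ≡⟨ solve 1 (λ k → con 64 :* k :+ con 282 := con 2 :* (con 32 :* k :+ con 141)) refl k ⟩
      2 · p                     ∎
    q≤p2 : q ≤ p · 2
    q≤p2 = ≤-trans q≤2p (≤-reflexive (*-comm 2 p))

-- Here 63 + 2j = 2k - 29, so that m is largest with 17m + 32 ≤ 2k + 3, the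
-- order of the core.
parameters-large : ∀ j → Parameters (46 + j)
parameters-large j = record
  -- With `t = 1` there are `2 · m + 3` labels, one fewer than gadgets.
  { m = m ; l = 2 · m + 4 ; w = w ; t = 1
  ; t≤1       = ≤-refl
  ; order     = begin-equality
      m + ((2 · m + 4) · 8 + w)      ≡⟨ solve 2 (λ m w → m :+ ((con 2 :* m :+ con 4) :* con 8 :+ w) := con 32 :+ (w :+ m :* con 17)) refl m w ⟩
      32 + (w + m · 17)              ≡⟨ cong (32 +_) (m≡m%n+[m/n]*n (63 + 2 · j) 17) ⟨
      32 + (63 + 2 · j)              ≡⟨ solve 1 (λ j → con 32 :+ (con 63 :+ con 2 :* j) := con 2 :* (con 46 :+ j) :+ con 1 :+ con 2) refl j ⟩
      2 · (46 + j) + 1 + 2           ∎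
  ; many      = ≤-reflexive (solve 1 (λ m → con 1 :+ (con 2 :+ (con 1 :+ (m :+ m))) := con 2 :* m :+ con 4) refl m)
  ; hub-cond  = begin
      q + (2 · m + 4) · 2 · (q ∸ 2 · p)    ≡⟨ cong₂ (λ q d → q + (2 · m + 4) · 2 · d) q≡ d≡ ⟩
      72 · j + 3234 + (2 · m + 4) · 2 · (8 · j + 8)
        -- Beyond the terms common to both sides, 136j + 3298 ≤ 1581m remains. It splits into 68
        -- times `47 + 2 · j ≤ m · 17`, which absorbs all of 136j, and 102 ≤ 425m.
        ≡⟨ solve 2 (λ j m → con 72 :* j :+ con 3234 :+ (con 2 :* m :+ con 4) :* con 2 :* (con 8 :* j :+ con 8)
             := con 32 :* j :* m :+ con 32 :* m :+ (con 68 :* (con 47 :+ con 2 :* j) :+ con 102)) refl j m ⟩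
      32 · j · m + 32 · m + (68 · (47 + 2 · j) + 102)
        ≤⟨ +-monoʳ-≤ (32 · j · m + 32 · m) (+-mono-≤ (*-monoʳ-≤ 68 47+2j≤17m) (≤-trans (toWitness {a? = 102 ≤? 425} _) (*-monoʳ-≤ 425 1≤m))) ⟩
      32 · j · m + 32 · m + (68 · (m · 17) + 425 · m)
        ≡⟨ solve 2 (λ j m → con 32 :* j :* m :+ con 32 :* m :+ (con 68 :* (m :* con 17) :+ con 425 :* m)
             := (con 32 :* (con 46 :+ j) :+ con 141) :* m) refl j m ⟩
      p · m                                ∎
  -- Here `q` exceeds `2 · p`, so two deletions would not pay for a component; `t = 1` provides
  -- four.
  ; core-cond = ≤-trans (far-cond (46 + j)) (*-monoʳ-≤ p (toWitness {a? = 3 ≤? 4} _))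
  }
  where
    open ≤-Reasoning
    open +-*-Solver
    m = (63 + 2 · j) / 17
    w = (63 + 2 · j) % 17
    q = 72 · (46 + j) ∸ 78
    p = 32 · (46 + j) + 141
    q≡ : q ≡ 72 · j + 3234
    q≡ = trans (cong (_∸ 78) (solve 1 (λ j → con 72 :* (con 46 :+ j) := con 72 :* j :+ con 3234 :+ con 78) refl j)) (m+n∸n≡m (72 · j + 3234) 78)
    d≡ : q ∸ 2 · p ≡ 8 · j + 8
    d≡ = trans (cong (_∸ 2 · p) (trans q≡ (solve 1 (λ j → con 72 :* j :+ con 3234 :=
           con 8 :* j :+ con 8 :+ con 2 :* (con 32 :* (con 46 :+ j) :+ con 141)) refl j))) (m+n∸n≡m (8 · j + 8) (2 · p))
    47+2j≤17m : 47 + 2 · j ≤ m · 17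
    47+2j≤17m = +-cancelˡ-≤ 16 _ _ (begin
      63 + 2 · j       ≡⟨ m≡m%n+[m/n]*n (63 + 2 · j) 17 ⟩
      w + m · 17       ≤⟨ +-monoˡ-≤ (m · 17) (≤-pred (m%n<n (63 + 2 · j) 17)) ⟩
      16 + m · 17      ∎)
    1≤m : 1 ≤ m
    1≤m = n≢0⇒n>0 λ m≡0 → <⇒≱ (≤-trans (s≤s z≤n) 47+2j≤17m) (≤-reflexive (cong (_· 17) m≡0))

parameters : ∀ k → 29 ≤ k → Parameters k
parameters k 29≤k with k ≤? 45
... | yes k≤45 = subst Parameters (m+[n∸m]≡n 29≤k) (parameters-small (k ∸ 29) (subst (_≤ 45) (sym (m+[n∸m]≡n 29≤k)) k≤45))
... | no k≰45  = subst Parameters (m+[n∸m]≡n (≰⇒> k≰45)) (parameters-large (k ∸ 46))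

-- The infinite family.

≅⇒≡ : ∀ {a b} {G : Graph a} {H : Graph b} → (∀ v → v ∈ Graph.V G) → (∀ v → v ∈ Graph.V H) → G ≅ H → a ≡ b
≅⇒≡ {G = G} {H} allG allH iso = ↔⇒≡ (mk↔ₛ′
  (λ u → proj₁ (Inverse.to φ (u , allG u))) (λ v → proj₁ (Inverse.from φ (v , allH v)))
  (λ v → trans (cong (proj₁ ∘ Inverse.to φ) (vertex-≡ {H = G} refl)) (cong proj₁ (Inverse.strictlyInverseˡ φ (v , allH v))))
  (λ u → trans (cong (proj₁ ∘ Inverse.from φ) (vertex-≡ {H = H} refl)) (cong proj₁ (Inverse.strictlyInverseʳ φ (u , allG u)))))
  where φ = _≅_.bijection iso

module _ {k : ℕ} (29≤k : 29 ≤ k) (parameters : Parameters k) (i : ℕ) where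
  open Parameters parameters

  -- Only the order of the `far` clique depends on `i`; the offset `2 · k + 2` meets the size
  -- condition of `far-bound`.
  graph : Graph (Construction.n m l w (2 · k + 2 + i))
  graph = Construction.G m l w (2 · k + 2 + i)

  graph-no-factor : ¬ HasP₂P₂ₖ₊₁Factor k graph
  graph-no-factor = NoFactor.no-factor {m} {l} {w} {2 · k + 2 + i} k t (≤-trans (s≤s z≤n) 29≤k) t≤1 order many

  graph-bound : ∀ X → (72 · k ∸ 78) · ∑-oddComponents k (graph - X) ≤ (32 · k + 141) · ∣ X ∣
  graph-bound X = Deletion.oddComponents-bound {m} {l} {w} {2 · k + 2 + i} k (32 · k + 141) (72 · k ∸ 78) X {t}
    order (m≤m+n (2 · k + 2) i) hub-cond core-cond (far-cond k)

  graph-boundℚ : ∀ X → fromℕ (∑-oddComponents k (graph - X)) ≤ℚ coefficient k 29≤k * fromℕ ∣ X ∣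
  graph-boundℚ X = ≤⇒≤ℚ (32 · k + 141) (72 · k ∸ 78) (∑-oddComponents k (graph - X)) ∣ X ∣ {{denominator≢0 k 29≤k}} (graph-bound X)

theorem2 : (k : ℕ) (29≤k : 29 ≤ k) →
    InfinitelyMany λ {n} G →
    ¬ HasP₂P₂ₖ₊₁Factor k G ×
    ((X : Subset n) → X ⊆ Graph.V G →
    fromℕ (∑-oddComponents k (G - X)) ≤ℚ coefficient k 29≤k * fromℕ ∣ X ∣)
theorem2 k 29≤k = (λ i → _ , graph 29≤k ps i) , distinct , λ i → graph-no-factor 29≤k ps i , λ X _ → graph-boundℚ 29≤k ps i X
  where
    ps : Parameters k
    ps = parameters k 29≤k
    open Parameters ps
    distinct : ∀ i j → i ≢ j → ¬ (graph 29≤k ps i ≅ graph 29≤k ps j)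
    -- An isomorphism forces equal orders, and cancelling the core and the offset leaves `i ≡ j`.
    distinct i j i≢j iso = i≢j (+-cancelˡ-≡ (2 · k + 2) i j (+-cancelˡ-≡ w _ _ (+-cancelˡ-≡ (l · 8) _ _
      (+-cancelˡ-≡ m _ _ (≅⇒≡ (λ _ → ∈⊤) (λ _ → ∈⊤) iso)))))
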